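{- Let $\mathbf{G}$ be any parameterized topology (a countable set of topologies). Then for all positive integers $k$ and $d$, the parameterized model checking problem for $\mathbf{G}$, process templates from $\mathcal{P}_u$, and specifications from $k$-indexed $\mathsf{CTL}^*_d\setminus\mathsf{X}$ has a cutoff; that is, there is a natural number $c$ such that for every $P\in\mathcal{P}_u$ and every such formula $\varphi$: $P^G\models\varphi$ for all $G\in\mathbf{G}$ with $|V_G|\le c$ if and only if $P^G\models\varphi$ for all $G\in\mathbf{G}$.
   Context: A labeled transition system (LTS) over a set of atoms is a tuple $(Q,Q_0,\Sigma,\delta,\lambda)$ with state set $Q$, initial states $Q_0\subseteq Q$, action labels $\Sigma$, transition relation $\delta\subseteq Q\times\Sigma\times Q$, and labeling $\lambda$ mapping each state to a finite set of atoms. Fix a countably infinite set $\mathsf{AP}_{pr}$ of atoms and a finite nonempty set $\Sigma_{int}$ of internal labels; let $\Sigma_{pr}=\Sigma_{int}\cup\{\mathsf{snd},\mathsf{rcv}\}$. A process template $P\in\mathcal{P}_u$ is an LTS $(Q,Q_0,\Sigma_{pr},\delta,\lambda)$ over $\mathsf{AP}_{pr}$ such that: $Q$ is finite and partitioned into nonempty sets $T$ (states "having the token") and $N$; $Q_0=\{\iota_t,\iota_n\}$ with $\iota_t\in T,\iota_n\in N$; every $\mathsf{snd}$-transition goes from $T$ to $N$; every $\mathsf{rcv}$-transition goes from $N$ to $T$; every internal transition goes from $T$ to $T$ or from $N$ to $N$; every state has an outgoing transition; and every infinite sequence of action labels along a path lies in $(\Sigma_{int}^*\,\mathsf{snd}\,\Sigma_{int}^*\,\mathsf{rcv})^\omega\cup(\Sigma_{int}^*\,\mathsf{rcv}\,\Sigma_{int}^*\,\mathsf{snd})^\omega$.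 A topology is a directed graph $G=(V,E,x)$ with $V=[n]$ for some $n\ge1$, initial vertex $x\in V$, and $E\subseteq V\times V$ without self-loops. The token-passing system $P^G$ is the LTS with states $Q^V$ (functions $s:V\to Q$); unique initial state $s_0$ with $s_0(x)=\iota_t$ and $s_0(v)=\iota_n$ for $v\neq x$; labeling: $p_i$ holds in $s$ iff $p\in\lambda(s(i))$; transitions: internal transitions $(s,a,s')$, $a\in\Sigma_{int}$, where one vertex $v$ takes a local transition $s(v)\xrightarrow{a}s'(v)$ and all other vertices are unchanged; and token-passing transitions $(s,\mathsf{tok},s')$ where for some $(v,w)\in E$, $s(v)\xrightarrow{\mathsf{snd}}s'(v)$ and $s(w)\xrightarrow{\mathsf{rcv}}s'(w)$ are local transitions and all other vertices are unchanged. $\mathsf{CTL}^*_d\setminus\mathsf{X}$ is the fragment of $\mathsf{CTL}^*$ without the next-time operator in which the nesting depth of path quantifiers is at most $d$. A $k$-indexed $\mathsf{CTL}^*_d\setminus\mathsf{X}$ formula has the form $Q_1x_1\dots Q_kx_k.\,\varphi$ where each $Q_ix_i$ is an index quantifier ($\forall$ or $\exists$ over vertices, possibly restricted as $x\in Y$ for a set $Y$ of index variables or $x\in E(y)$ for the out-neighbours of the vertex denoted by $y$) and $\varphi$ is a $\mathsf{CTL}^*_d\setminus\mathsf{X}$ formula over atoms $p_{x_j}$ ($p\in\mathsf{AP}_{pr}$, $j\le k$). Semantics: $P^G\models Q_1x_1\dots Q_kx_k.\varphi$ iff $Q_1g_1\in V_G\dots Q_kg_k\in V_G$: $P^G\models\varphi[p_{x_j}\mapsto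 p_{g_j}]$. -}

module Defs where

open import Data.Nat using (ℕ; zero; suc; _<_; _≤_; _⊔_; _*_)
open import Data.Fin using (Fin; _≟_)
open import Data.Bool using (Bool; true; false; if_then_else_)
open import Data.List using (List)
open import Data.List.Membership.Propositional using (_∈_)
open import Data.List.Relation.Unary.Any using (Any)
open import Data.Vec using (Vec; []; _∷ʳ_; lookup)
open import Data.Product using (Σ; _×_; _,_; ∃; ∃₂)
open import Data.Sum using (_⊎_)
open import Data.Unit using (⊤)
open import Data.Empty using (⊥)
open import Relation.Nullary using (¬_)
open import Relation.Nullary.Decidable using (⌊_⌋)
open import Relation.Binary.PropositionalEquality using (_≡_; _≢_)

-- Action labels Σ_pr = Σ_int ∪ {snd, rcv}, with Σ_int = Fin (suc m)
-- (an arbitrary finite nonempty set).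

data PLab (m : ℕ) : Set where
  int : Fin (suc m) → PLab m
  snd : PLab m
  rcv : PLab m

IsInt : ∀ {m} → PLab m → Set
IsInt (int _) = ⊤
IsInt snd     = ⊥
IsInt rcv     = ⊥

-- w ∈ (Σ_int* a Σ_int* b)^ω : there is a strictly increasing sequence f of
-- positions such that the letters at f(2i) are a, at f(2i+1) are b, and every
-- non-internal letter occurs at some position f(i).
InBlocks : ∀ {m} → PLab m → PLab m → (ℕ → PLab m) → Set
InBlocks a b w =
  Σ (ℕ → ℕ) λ f →
    (∀ i → f i < f (suc i)) ×
    (∀ i → (w (f (2 * i)) ≡ a) × (w (f (suc (2 * i))) ≡ b)) ×
    (∀ n → ¬ IsInt (w n) → ∃ λ i → f i ≡ n)

-- Process templates P ∈ 𝒫_u.  Atoms AP_pr = ℕ.  Q = Fin nQ,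
-- T = {q | tok q ≡ true}, N = {q | tok q ≡ false}; Q₀ = {ιt, ιn}.

record Template (m : ℕ) : Set where
  field
    nQ     : ℕ
    tok    : Fin nQ → Bool
    ιt     : Fin nQ
    ιn     : Fin nQ
    ιt∈T   : tok ιt ≡ true
    ιn∈N   : tok ιn ≡ false
    δ      : Fin nQ → PLab m → Fin nQ → Bool
    lab    : Fin nQ → List ℕ
    snd-TN : ∀ q q' → δ q snd q' ≡ true → (tok q ≡ true) × (tok q' ≡ false)
    rcv-NT : ∀ q q' → δ q rcv q' ≡ true → (tok q ≡ false) × (tok q' ≡ true)
    int-TT-NN : ∀ q a q' → δ q (int a) q' ≡ true → tok q ≡ tok q'
    total  : ∀ q → ∃₂ λ a q' → δ q a q' ≡ true
    paths  : (s : ℕ → Fin nQ) (w : ℕ → PLab m) →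
             (∀ i → δ (s i) (w i) (s (suc i)) ≡ true) →
             InBlocks snd rcv w ⊎ InBlocks rcv snd w

-- Topologies G = (V, E, x) with V = Fin n (n ≥ 1 since x : Fin n).

record Topology : Set where
  field
    n      : ℕ
    E      : Fin n → Fin n → Bool
    noLoop : ∀ v → E v v ≡ false
    x      : Fin n

mutual
  data SF (A : Set) : Set where
    atom : A → SF A
    tt   : SF A
    ¬ₛ_  : SF A → SF A
    _∧ₛ_ : SF A → SF A → SF A
    _∨ₛ_ : SF A → SF A → SF A
    Eₚ   : PF A → SF A
    Aₚ   : PF A → SF A

  data PF (A : Set) : Set where
    st   : SF A → PF A
    ¬ₚ_  : PF A → PF A
    _∧ₚ_ : PF A → PF A → PF A
    _∨ₚ_ : PF A → PF A → PF A
    _U_  : PF A → PF A → PF A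

mutual
  depthS : ∀ {A} → SF A → ℕ
  depthS (atom _) = 0
  depthS tt = 0
  depthS (¬ₛ φ) = depthS φ
  depthS (φ ∧ₛ ψ) = depthS φ ⊔ depthS ψ
  depthS (φ ∨ₛ ψ) = depthS φ ⊔ depthS ψ
  depthS (Eₚ ψ) = suc (depthP ψ)
  depthS (Aₚ ψ) = suc (depthP ψ)

  depthP : ∀ {A} → PF A → ℕ
  depthP (st φ) = depthS φ
  depthP (¬ₚ ψ) = depthP ψ
  depthP (ψ ∧ₚ χ) = depthP ψ ⊔ depthP χ
  depthP (ψ ∨ₚ χ) = depthP ψ ⊔ depthP χ
  depthP (ψ U χ) = depthP ψ ⊔ depthP χ

module Sem (S : Set) (Step : S → S → Set) (At : Set) (L : S → At → Set) where

  ValidFrom : S → (ℕ → S) → Set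
  ValidFrom s ρ = Step s (ρ 0) × (∀ i → Step (ρ i) (ρ (suc i)))

  _⊙_ : S → (ℕ → S) → ℕ → S
  (s ⊙ ρ) zero    = s
  (s ⊙ ρ) (suc i) = ρ i

  suffix : ℕ → (ℕ → S) → ℕ → S
  suffix j π i = π (j Data.Nat.+ i)

  mutual
    _⊨ₛ_ : S → SF At → Set
    s ⊨ₛ atom a  = L s a
    s ⊨ₛ tt      = ⊤
    s ⊨ₛ (¬ₛ φ)  = ¬ (s ⊨ₛ φ)
    s ⊨ₛ (φ ∧ₛ ψ) = (s ⊨ₛ φ) × (s ⊨ₛ ψ)
    s ⊨ₛ (φ ∨ₛ ψ) = (s ⊨ₛ φ) ⊎ (s ⊨ₛ ψ)
    s ⊨ₛ (Eₚ ψ)   = Σ (ℕ → S) λ ρ → ValidFrom s ρ × ((s ⊙ ρ) ⊨ₚ ψ)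
    s ⊨ₛ (Aₚ ψ)   = (ρ : ℕ → S) → ValidFrom s ρ → (s ⊙ ρ) ⊨ₚ ψ

    _⊨ₚ_ : (ℕ → S) → PF At → Set
    π ⊨ₚ st φ     = π 0 ⊨ₛ φ
    π ⊨ₚ (¬ₚ ψ)   = ¬ (π ⊨ₚ ψ)
    π ⊨ₚ (ψ ∧ₚ χ) = (π ⊨ₚ ψ) × (π ⊨ₚ χ)
    π ⊨ₚ (ψ ∨ₚ χ) = (π ⊨ₚ ψ) ⊎ (π ⊨ₚ χ)
    π ⊨ₚ (ψ U χ)  = Σ ℕ λ j → (suffix j π ⊨ₚ χ) × (∀ i → i < j → suffix i π ⊨ₚ ψ)

module _ {m : ℕ} (P : Template m) (G : Topology) where
  open Template P
  open Topology G

  GState : Set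
  GState = Fin n → Fin nQ

  s₀ : GState
  s₀ v = if ⌊ v ≟ x ⌋ then ιt else ιn

  data GStep (s s' : GState) : Set where
    internal : (a : Fin (suc m)) (v : Fin n) →
               δ (s v) (int a) (s' v) ≡ true →
               (∀ u → u ≢ v → s' u ≡ s u) → GStep s s'
    token    : (v w : Fin n) → E v w ≡ true →
               δ (s v) snd (s' v) ≡ true →
               δ (s w) rcv (s' w) ≡ true →
               (∀ u → u ≢ v → u ≢ w → s' u ≡ s u) → GStep s s'

  GLab : GState → ℕ × Fin n → Set
  GLab s (p , i) = p ∈ lab (s i)

data Kind : Set where
  ∀ᵢ : Kind
  ∃ᵢ : Kind

-- restriction of the quantifier binding variable number j
-- (variables 0 … j-1 are already bound)
data Restr (j : ℕ) : Set where
  free  : Restr j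
  inVar : List (Fin j) → Restr j   -- x ∈ Y,  Y a set of index variables
  inOut : Fin j → Restr j          -- x ∈ E(y)

-- Prefix j k binds variables j, …, k-1 in order
data Prefix : ℕ → ℕ → Set where
  done : ∀ {k} → Prefix k k
  _∷_  : ∀ {j k} → Kind × Restr j → Prefix (suc j) k → Prefix j k

record IFormula (k : ℕ) : Set where
  constructor _∙_
  field
    prefix : Prefix 0 k
    body   : SF (ℕ × Fin k)      -- atom (p , j) stands for p_{x_j}
open IFormula public

IsCTLd : ∀ {k} → ℕ → IFormula k → Set
IsCTLd d φ = depthS (body φ) ≤ d

module _ {m : ℕ} (P : Template m) (G : Topology) where
  open Topology G

  Allowed : ∀ {j} → Restr j → Vec (Fin n) j → Fin n → Set
  Allowed free      env v = ⊤
  Allowed (inVar Y) env v = Any (λ y → lookup env y ≡ v) Y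
  Allowed (inOut y) env v = E (lookup env y) v ≡ true

  Quant : ∀ {j k} → Prefix j k → Vec (Fin n) j → (Vec (Fin n) k → Set) → Set
  Quant done env B = B env
  Quant ((∀ᵢ , r) ∷ p) env B = (v : Fin n) → Allowed r env v → Quant p (env ∷ʳ v) B
  Quant ((∃ᵢ , r) ∷ p) env B = Σ (Fin n) λ v → Allowed r env v × Quant p (env ∷ʳ v) B

  ILab : ∀ {k} → Vec (Fin n) k → GState P G → ℕ × Fin k → Set
  ILab env s (p , j) = GLab P G s (p , lookup env j)

  _⊨_ : ∀ {k} → IFormula k → Set
  _⊨_ {k} φ = Quant (prefix φ) []
    (λ env → Sem._⊨ₛ_ (GState P G) (GStep P G) (ℕ × Fin k) (ILab env) (s₀ P G) (body φ))

{-# OPTIONS --safe #-}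
-- Whether P^G satisfies a formula of nesting depth d with k tracked vertices
-- depends only on a finite amount of information about G, independent of P:
-- untracked processes can always move on internally, invisibly, until they are
-- ready to send or receive, so only the route of the token matters.  Vertices are
-- coloured by iterated refinement.  The level-0 colour of v says which tracked
-- vertices v equals; the level-(d+1) colour records which level-d colour changes
-- can be realised along paths from v, and whether a path can stay forever in one
-- level-d colour.  Along untracked vertices these sets can only shrink, so between
-- two visits to tracked vertices the colour changes a bounded number of times, and
-- bounded unfolding of such changes suffices to match every run, up to stuttering,
-- at the next lower level.  Hence there are finitely many types of topologies, and
-- the cutoff is the largest size among one representative in 𝐆 of each type.
module Submission where

open import Defs
open import Data.Nat using (ℕ; zero; suc; _+_; _*_; _^_; _⊔_; _≤_; _<_; z≤n; s≤s;
  _≤‴_; ≤‴-refl; ≤‴-step; ≤‴-reflexive)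
open import Data.Nat.Properties as ℕ hiding (_≟_)
open import Data.Bool using (Bool; true; false)
open import Data.Fin using (Fin; zero; suc; _≟_; combine)
open import Data.Fin.Properties using (combine-injective)
open import Data.Fin.Subset using (Subset; ∣_∣)
open import Data.Fin.Subset.Properties using (∣p∣≤n)
open import Data.List.Membership.Propositional using (_∈_)
open import Data.List.Relation.Unary.Any as Any using (Any)
open import Data.Vec using (Vec; []; _∷_; _∷ʳ_; lookup; tabulate)
open import Data.Vec.Properties using (lookup∘tabulate)
open import Data.Product using (Σ; _×_; _,_; ∃; proj₁; proj₂; map₂)
open import Data.Sum using (_⊎_; inj₁; inj₂; [_,_]′)
open import Data.Empty using (⊥-elim)
open import Function using (_∘_; id)
open import Function.Bundles using (_⇔_; mk⇔)
open import Induction.WellFounded using (Acc; acc)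
open import Relation.Nullary using (Dec; yes; no; does; ¬_; contradiction)
open import Relation.Nullary.Decidable using (dec-true)
open import Relation.Binary.PropositionalEquality using (_≡_; _≢_; refl; sym; trans; cong; cong₂; subst; subst₂)
open import Relation.Binary.Construct.Closure.Transitive using (TransClosure; [_]; _∷_; _++_)
open import Relation.Binary.Construct.Closure.ReflexiveTransitive using (Star; ε; _◅_)
open import Level using (0ℓ)
open import Axiom.ExcludedMiddle using (ExcludedMiddle)

-- Slow unbounded sequences and stuttering matches of runs.

Slow : (ℕ → ℕ) → Set
Slow a = ∀ i → a i ≤ a (suc i) × a (suc i) ≤ suc (a i)

Unbounded : (ℕ → ℕ) → Set
Unbounded a = ∀ b → ∃ λ i → b ≤ a i

slow-mono : ∀ {a} → Slow a → ∀ j i → a i ≤ a (j + i)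
slow-mono sl zero    i = ≤-refl
slow-mono sl (suc j) i = ≤-trans (slow-mono sl j i) (proj₁ (sl (j + i)))

slow-shift : ∀ {a} → Slow a → ∀ j → Slow (λ i → a (j + i))
slow-shift sl j i rewrite +-suc j i = sl (j + i)

unbounded-shift : ∀ {a} → Slow a → Unbounded a → ∀ j → Unbounded (λ i → a (j + i))
unbounded-shift sl unb j b with unb b
... | i , b≤ = i , ≤-trans b≤ (slow-mono sl j i)

-- A sequence growing by at most one per step skips no value. That all earlier values stay below `b`
-- is what the until operator needs.
first-hit : ∀ {a} → Slow a → ∀ {b} → a 0 ≤ b → ∀ i → b ≤ a i →
            Σ ℕ λ j → j ≤ i × a j ≡ b × (∀ l → l < j → a l < b)
first-hit {a} sl {b} a0≤b i b≤ai with a 0 ℕ.≟ b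
... | yes eq = 0 , z≤n , eq , λ _ ()
first-hit sl a0≤b zero    b≤ai | no ne with () ← ne (≤-antisym a0≤b b≤ai)
first-hit {a} sl {b} a0≤b (suc i) b≤ai | no ne
  with j , j≤i , eq , below ← first-hit (λ l → sl (suc l))
         (≤-trans (proj₂ (sl 0)) (≤∧≢⇒< a0≤b ne)) i b≤ai
  = suc j , s≤s j≤i , eq , below′
  where
  below′ : ∀ l → l < suc j → a l < b
  below′ zero    _         = ≤∧≢⇒< a0≤b ne
  below′ (suc l) (s≤s l<j) = below l l<j

-- blk and blk′ number the stuttering blocks of the two runs; they need not
-- start at 0, so that suffixes are matched by shifting the numberings.
record Match {S S′ : Set} (R : S → S′ → Set) (π : ℕ → S) (π′ : ℕ → S′) : Set where
  field
    blk   : ℕ → ℕ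
    blk′  : ℕ → ℕ
    start : blk 0 ≡ blk′ 0
    slow  : Slow blk
    slow′ : Slow blk′
    unb   : Unbounded blk
    unb′  : Unbounded blk′
    rel   : ∀ i j → blk i ≡ blk′ j → R (π i) (π′ j)

match-sym : ∀ {S S′ : Set} {R : S → S′ → Set} {R′ : S′ → S → Set} {π π′} →
            (∀ {s t} → R s t → R′ t s) → Match R π π′ → Match R′ π′ π
match-sym f M = record
  { blk = blk′ ; blk′ = blk ; start = sym start ; slow = slow′ ; slow′ = slow
  ; unb = unb′ ; unb′ = unb ; rel = λ i j eq → f (rel j i (sym eq)) }
  where open Match M

match-resp : ∀ {S S′ : Set} {R : S → S′ → Set} {π π′ ρ} → (∀ i → π′ i ≡ ρ i) →
             Match R π π′ → Match R π ρ
match-resp {R = R} {π} eq M = record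
  { Match M ; rel = λ i j e → subst (R (π i)) (eq j) (Match.rel M i j e) }

match-suffix : ∀ {S S′ : Set} {R : S → S′ → Set} {π π′} (M : Match R π π′) →
               ∀ j j′ → Match.blk M j ≡ Match.blk′ M j′ →
               Match R (λ i → π (j + i)) (λ i → π′ (j′ + i))
match-suffix M j j′ eq = record
  { blk = λ i → blk (j + i) ; blk′ = λ i → blk′ (j′ + i)
  ; start = trans (cong blk (+-identityʳ j)) (trans eq (sym (cong blk′ (+-identityʳ j′))))
  ; slow = slow-shift slow j ; slow′ = slow-shift slow′ j′
  ; unb = unbounded-shift slow unb j ; unb′ = unbounded-shift slow′ unb′ j′
  ; rel = λ i i′ → rel (j + i) (j′ + i′) }
  where open Match M

-- Preservation of formulas under graded stuttering simulation.

module Transfer {I : Set} (S : I → Set) (Step : ∀ i → S i → S i → Set)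
  (At : Set) (L : ∀ i → S i → At → Set)
  (R : ℕ → ∀ i j → S i → S j → Set)
  (R-sym : ∀ d {i j s t} → R d i j s t → R d j i t s)
  (R-atom : ∀ d {i j s t} a → R d i j s t → L i s a → L j t a)
  (R-run : ∀ d {i j s t} → R (suc d) i j s t → ∀ ρ → Sem.ValidFrom (S i) (Step i) At (L i) s ρ →
           Σ (ℕ → S j) λ ρ′ → Sem.ValidFrom (S j) (Step j) At (L j) t ρ′ ×
             Match (R d i j) (Sem._⊙_ (S i) (Step i) At (L i) s ρ)
                             (Sem._⊙_ (S j) (Step j) At (L j) t ρ′))
  where

  module System (i : I) = Sem (S i) (Step i) At (L i)
  open System

  mutual
    -- Each path quantifier spends one level of `R` through `R-run`. Symmetry serves negation and
    -- `Aₚ`, where the run is pulled back from the second system.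
    transferₛ : ∀ d {i j s t} φ → depthS φ ≤ d → R d i j s t → _⊨ₛ_ i s φ → _⊨ₛ_ j t φ
    transferₛ d (atom a) _ r h = R-atom d a r h
    transferₛ d tt _ r h = h
    transferₛ d (¬ₛ φ) le r h h′ = h (transferₛ d φ le (R-sym d r) h′)
    transferₛ d (φ ∧ₛ ψ) le r (h , h′) =
      transferₛ d φ (m⊔n≤o⇒m≤o _ _ le) r h , transferₛ d ψ (m⊔n≤o⇒n≤o (depthS φ) _ le) r h′
    transferₛ d (φ ∨ₛ ψ) le r (inj₁ h) = inj₁ (transferₛ d φ (m⊔n≤o⇒m≤o _ _ le) r h)
    transferₛ d (φ ∨ₛ ψ) le r (inj₂ h) = inj₂ (transferₛ d ψ (m⊔n≤o⇒n≤o (depthS φ) _ le) r h)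
    transferₛ (suc d) (Eₚ ψ) (s≤s le) r (ρ , val , h) with ρ′ , val′ , M ← R-run d r ρ val =
      ρ′ , val′ , transferₚ d ψ le M h
    transferₛ (suc d) (Aₚ ψ) (s≤s le) r h ρ′ val′ with ρ , val , M ← R-run d (R-sym (suc d) r) ρ′ val′ =
      transferₚ d ψ le (match-sym (R-sym d) M) (h ρ val)

    transferₚ : ∀ d {i j π π′} ψ → depthP ψ ≤ d → Match (R d i j) π π′ →
                _⊨ₚ_ i π ψ → _⊨ₚ_ j π′ ψ
    transferₚ d (st φ) le M h = transferₛ d φ le (Match.rel M 0 0 (Match.start M)) h
    transferₚ d (¬ₚ ψ) le M h h′ = h (transferₚ d ψ le (match-sym (R-sym d) M) h′)
    transferₚ d (ψ ∧ₚ χ) le M (h , h′) =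
      transferₚ d ψ (m⊔n≤o⇒m≤o _ _ le) M h , transferₚ d χ (m⊔n≤o⇒n≤o (depthP ψ) _ le) M h′
    transferₚ d (ψ ∨ₚ χ) le M (inj₁ h) = inj₁ (transferₚ d ψ (m⊔n≤o⇒m≤o _ _ le) M h)
    transferₚ d (ψ ∨ₚ χ) le M (inj₂ h) = inj₂ (transferₚ d χ (m⊔n≤o⇒n≤o (depthP ψ) _ le) M h)
    transferₚ d {i = i} {j} {π} {π′} (ψ U χ) le M (n , hχ , hψ)
      -- The witness is the first position of `π′` in the block of `n`; everything before it lies in
      -- smaller blocks.
      with n′ , _ , eq , below ← first-hit (Match.slow′ M)
             (subst (_≤ Match.blk M n) (Match.start M)
               (subst (λ l → Match.blk M 0 ≤ Match.blk M l) (+-identityʳ n)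
                 (slow-mono (Match.slow M) n 0)))
             (proj₁ (Match.unb′ M (Match.blk M n))) (proj₂ (Match.unb′ M (Match.blk M n)))
      = n′ , transferₚ d χ (m⊔n≤o⇒n≤o (depthP ψ) _ le) (match-suffix M n n′ (sym eq)) hχ , before
      where
      open Match M
      before : ∀ l′ → l′ < n′ → _⊨ₚ_ j (suffix j l′ π′) ψ
      -- The block of `l′` is smaller than that of `n`, so its first position `l` in `π` precedes
      -- `n`, where `ψ` is known.
      before l′ l′<n′
        with l , l≤n , eq′ , _ ← first-hit slow {blk′ l′}
               (subst (_≤ blk′ l′) (sym start)
                 (subst (λ l → blk′ 0 ≤ blk′ l) (+-identityʳ l′) (slow-mono slow′ l′ 0)))
               n (<⇒≤ (below l′ l′<n′))
        = transferₚ d ψ (m⊔n≤o⇒m≤o _ _ le) (match-suffix M l l′ eq′)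
            (hψ l (≤∧≢⇒< l≤n λ { refl → <-irrefl (sym eq′) (below l′ l′<n′) }))

-- Concatenating finite segments into an infinite run.

module Unroll {X : Set} (St : X → X → Set) (at : ℕ → X) (K : ℕ → X → Set)
  (seg : ∀ n → TransClosure (λ x y → K n x × St x y) (at n) (at (suc n))) where

  -- The rest of a segment is nonempty, so every advance is a genuine step, and finite, so every
  -- segment number is reached.
  Micro : Set
  Micro = Σ ℕ λ n → Σ X λ x → TransClosure (λ x y → K n x × St x y) x (at (suc n))

  begin : ℕ → Micro
  begin n = n , at n , seg n

  advance : Micro → Micro
  advance (n , x , [ _ ])    = begin (suc n)
  advance (n , x , _ ∷ rest) = n , _ , rest

  micro : ℕ → Micro
  micro zero    = begin 0
  micro (suc i) = advance (micro i)

  blk : ℕ → ℕ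
  blk i = proj₁ (micro i)

  run : ℕ → X
  run i = proj₁ (proj₂ (micro i))

  run-step : ∀ i → St (run i) (run (suc i))
  run-step i with micro i
  ... | n , x , [ _ , s ]   = s
  ... | n , x , (_ , s) ∷ _ = s

  run-K : ∀ i → K (blk i) (run i)
  run-K i with micro i
  ... | n , x , [ k , _ ]   = k
  ... | n , x , (k , _) ∷ _ = k

  blk-slow : Slow blk
  blk-slow i with micro i
  ... | n , x , [ _ ]  = n≤1+n n , ≤-refl
  ... | n , x , _ ∷ _ = ≤-refl , n≤1+n n

  finish : ∀ i {n x} (p : TransClosure _ x _) → micro i ≡ (n , x , p) →
           ∃ λ j → micro j ≡ begin (suc n)
  finish i [ _ ]   eq = suc i , cong advance eq
  finish i {n} (_∷_ {y = y} _ p) eq = finish (suc i) {n} {y} p (cong advance eq)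

  reach : ∀ b → ∃ λ i → micro i ≡ begin b
  reach zero    = 0 , refl
  reach (suc b) with i , eq ← reach b = finish i _ eq

  blk-unb : Unbounded blk
  blk-unb b with i , eq ← reach b = i , ≤-reflexive (sym (cong proj₁ eq))

-- Subsets of finite sets as numbers.

bit : Bool → Fin 2
bit false = zero
bit true  = suc zero

bit-injective : ∀ b c → bit b ≡ bit c → b ≡ c
bit-injective false false _ = refl
bit-injective true  true  _ = refl

encode : ∀ {n} → Subset n → Fin (2 ^ n)
encode []      = zero
encode (b ∷ p) = combine (bit b) (encode p)

encode-injective : ∀ {n} (p q : Subset n) → encode p ≡ encode q → p ≡ q
encode-injective []      []      _  = refl
encode-injective (b ∷ p) (c ∷ q) eq
  with eqb , eqp ← combine-injective (bit b) (encode p) (bit c) (encode q) eq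
  = cong₂ _∷_ (bit-injective b c eqb) (encode-injective p q eqp)

-- Makes a shrinking set usable as a measure: unless the set stays the same, its cardinality drops.
⊆⇒≡⊎< : ∀ {n} (p q : Subset n) → (∀ x → lookup p x ≡ true → lookup q x ≡ true) →
        p ≡ q ⊎ ∣ p ∣ < ∣ q ∣
⊆⇒≡⊎< []      []      _   = inj₁ refl
⊆⇒≡⊎< (b ∷ p) (c ∷ q) p⊆q with ⊆⇒≡⊎< p q (λ x → p⊆q (suc x))
⊆⇒≡⊎< (false ∷ p) (false ∷ q) _   | inj₁ eq = inj₁ (cong (false ∷_) eq)
⊆⇒≡⊎< (false ∷ p) (false ∷ q) _   | inj₂ lt = inj₂ lt
⊆⇒≡⊎< (false ∷ p) (true  ∷ q) _   | inj₁ eq = inj₂ (s≤s (≤-reflexive (cong ∣_∣ eq)))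
⊆⇒≡⊎< (false ∷ p) (true  ∷ q) _   | inj₂ lt = inj₂ (m<n⇒m<1+n lt)
⊆⇒≡⊎< (true  ∷ p) (true  ∷ q) _   | inj₁ eq = inj₁ (cong (true ∷_) eq)
⊆⇒≡⊎< (true  ∷ p) (true  ∷ q) _   | inj₂ lt = inj₂ (s≤s lt)
⊆⇒≡⊎< (true  ∷ p) (false ∷ q) p⊆q | _ with () ← p⊆q zero refl

-- Topologies with tracked vertices, and their colourings.

record Pointed (k : ℕ) : Set where
  constructor _▹_
  field
    top : Topology
    env : Vec (Fin (Topology.n top)) k
open Pointed public

module _ {k : ℕ} (𝓖 : Pointed k) where
  open Topology (top 𝓖)

  V : Set
  V = Fin n

  var : Fin k → V
  var = lookup (env 𝓖)

  Edge : V → V → Set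
  Edge v w = E v w ≡ true

  Untracked : V → Set
  Untracked v = ∀ i → var i ≢ v

  no-loop : ∀ {v w} → Edge v w → v ≢ w
  no-loop {v} e refl with () ← trans (sym e) (noLoop v)

  module _ {N : ℕ} (c : V → Fin N) where

    -- A stretch inside one colour class counts as stuttering; only the first vertex of the next
    -- class is exposed.
    data Crosses (v w : V) : Set where
      last : Edge v w → c w ≢ c v → Crosses v w
      cons : ∀ {u} → Edge v u → c u ≡ c v → Crosses u w → Crosses v w

    -- Divergence as in divergence-sensitive stuttering equivalence: crossings alone do not show
    -- whether the token may remain in its class forever.
    Div : V → Set
    Div v = Σ (ℕ → V) λ ρ → ρ 0 ≡ v × (∀ i → Edge (ρ i) (ρ (suc i)) × c (ρ i) ≡ c v)

    div-cons : ∀ {v u} → Edge v u → c u ≡ c v → Div u → Div v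
    div-cons {v} e eq (ρ , refl , walk) = ρ′ , refl , walk′
      where
      ρ′ : ℕ → V
      ρ′ zero    = v
      ρ′ (suc i) = ρ i
      walk′ : ∀ i → Edge (ρ′ i) (ρ′ (suc i)) × c (ρ′ i) ≡ c v
      walk′ zero    = e , refl
      walk′ (suc i) = proj₁ (walk i) , trans (proj₂ (walk i)) eq

-- The measure μ strictly drops whenever the colour changes along an edge between
-- untracked vertices, so it bounds the number of such changes.
record Colouring (k : ℕ) : Set where
  field
    N     : ℕ
    col   : (𝓖 : Pointed k) → V 𝓖 → Fin N
    bound : ℕ
    μ     : (𝓖 : Pointed k) → V 𝓖 → ℕ
    μ≤    : ∀ 𝓖 v → μ 𝓖 v ≤ bound
    mono  : ∀ 𝓖 {v w} → Edge 𝓖 v w → Untracked 𝓖 v → Untracked 𝓖 w →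
            (col 𝓖 w ≡ col 𝓖 v × μ 𝓖 w ≤ μ 𝓖 v) ⊎ (μ 𝓖 w < μ 𝓖 v)
    loc   : ∀ 𝓖 ℋ {v w} → col 𝓖 v ≡ col ℋ w → ∀ {i} → var 𝓖 i ≡ v → var ℋ i ≡ w

  untracked-resp : ∀ 𝓖 ℋ {v w} → col 𝓖 v ≡ col ℋ w → Untracked 𝓖 v → Untracked ℋ w
  untracked-resp 𝓖 ℋ eq un i eq′ = un i (loc ℋ 𝓖 (sym eq) eq′)

  -- If `v` were `var 𝓖 i`, equal colours would put `var 𝓖 i` at `w` as well, and the edge would be
  -- a loop.
  same-colour-untracked : ∀ 𝓖 {v w} → Edge 𝓖 v w → col 𝓖 w ≡ col 𝓖 v →
                          Untracked 𝓖 v × Untracked 𝓖 w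
  same-colour-untracked 𝓖 e eq = un , untracked-resp 𝓖 𝓖 (sym eq) un
    where
    un : Untracked 𝓖 _
    un i refl = no-loop 𝓖 e (loc 𝓖 𝓖 (sym eq) refl)

-- Refinement of colourings.

module Refinement (em : ExcludedMiddle 0ℓ) where

  sub : ∀ {n} → (Fin n → Set) → Subset n
  sub P = tabulate λ x → does (em {P x})

  ∈sub⁻ : ∀ {n} {P : Fin n → Set} x → lookup (sub P) x ≡ true → P x
  ∈sub⁻ {P = P} x eq with em {P x} | trans (sym (lookup∘tabulate (λ x → does (em {P x})) x)) eq
  ... | yes p | _ = p
  ... | no _  | ()

  ∈sub⁺ : ∀ {n} {P : Fin n → Set} x → P x → lookup (sub P) x ≡ true
  ∈sub⁺ {P = P} x p = trans (lookup∘tabulate _ x) (dec-true (em {P x}) p)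

  -- Excluded middle turns a predicate into a number, so that observations made in different
  -- topologies can be compared by equality.
  code : ∀ {n} → (Fin n → Set) → Fin (2 ^ n)
  code P = encode (sub P)

  code-elim : ∀ {n} (P P′ : Fin n → Set) → code P ≡ code P′ → ∀ {x} → P x → P′ x
  code-elim P P′ eq {x} p =
    ∈sub⁻ x (trans (cong (λ q → lookup q x) (sym (encode-injective (sub P) (sub P′) eq)))
                   (∈sub⁺ x p))

  sub-⊆ : ∀ {n} {P P′ : Fin n → Set} → (∀ {x} → P x → P′ x) →
          sub P ≡ sub P′ ⊎ ∣ sub P ∣ < ∣ sub P′ ∣
  sub-⊆ {P = P} {P′} imp = ⊆⇒≡⊎< (sub P) (sub P′) λ x h → ∈sub⁺ x (imp (∈sub⁻ x h))

  tracked? : ∀ {k} (𝓖 : Pointed k) v → Untracked 𝓖 v ⊎ ∃ λ i → var 𝓖 i ≡ v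
  tracked? 𝓖 v with em {∃ λ i → var 𝓖 i ≡ v}
  ... | yes p = inj₂ p
  ... | no ¬p = inj₁ λ i eq → ¬p (i , eq)

  -- All untracked vertices carry the code of the empty set, so no colour change occurs between them
  -- and the zero measure works.
  location : ∀ k → Colouring k
  location k = record
    { N = 2 ^ k ; col = col ; bound = 0 ; μ = λ _ _ → 0 ; μ≤ = λ _ _ → z≤n
    ; mono = λ 𝓖 _ unv unw → inj₁ (untracked-≡ 𝓖 unv unw , z≤n)
    ; loc = λ 𝓖 ℋ {v} {w} eq → code-elim (λ i → var 𝓖 i ≡ v) (λ i → var ℋ i ≡ w) eq }
    where
    col : (𝓖 : Pointed k) → V 𝓖 → Fin (2 ^ k)
    col 𝓖 v = code λ i → var 𝓖 i ≡ v
    untracked-≡ : ∀ 𝓖 {v w} → Untracked 𝓖 v → Untracked 𝓖 w → col 𝓖 w ≡ col 𝓖 v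
    untracked-≡ 𝓖 {v} {w} unv unw
      with sub-⊆ {P = λ i → var 𝓖 i ≡ w} {λ i → var 𝓖 i ≡ v} (λ h → ⊥-elim (unw _ h))
         | sub-⊆ {P = λ i → var 𝓖 i ≡ v} {λ i → var 𝓖 i ≡ w} (λ h → ⊥-elim (unv _ h))
    ... | inj₁ eq | _       = cong encode eq
    ... | inj₂ _  | inj₁ eq = cong encode (sym eq)
    ... | inj₂ lt | inj₂ gt = contradiction gt (<-asym lt)

  module Refine {k : ℕ} (C : Colouring k) where
    open Colouring C

    -- Colour j of v records what can be seen from v along paths with at most j
    -- changes of the C-colour.
    size : ℕ → ℕ
    size zero    = N
    size (suc j) = N * 2 ^ suc (size j)

    mutual
      colour : ∀ j (𝓖 : Pointed k) → V 𝓖 → Fin (size j)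
      colour zero    𝓖 v = col 𝓖 v
      colour (suc j) 𝓖 v = combine (col 𝓖 v) (code (Future j 𝓖 v))

      Future : ∀ j (𝓖 : Pointed k) → V 𝓖 → Fin (suc (size j)) → Set
      Future j 𝓖 v zero    = Div 𝓖 (col 𝓖) v
      Future j 𝓖 v (suc x) = Σ (V 𝓖) λ w → Crosses 𝓖 (col 𝓖) v w × colour j 𝓖 w ≡ x

    colour-col : ∀ j 𝓖 ℋ {v w} → colour j 𝓖 v ≡ colour j ℋ w → col 𝓖 v ≡ col ℋ w
    colour-col zero    𝓖 ℋ eq = eq
    colour-col (suc j) 𝓖 ℋ eq = proj₁ (combine-injective (col 𝓖 _) _ (col ℋ _) _ eq)

    colour-future : ∀ j 𝓖 ℋ {v w} → colour (suc j) 𝓖 v ≡ colour (suc j) ℋ w →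
                    ∀ {x} → Future j 𝓖 v x → Future j ℋ w x
    colour-future j 𝓖 ℋ {v} {w} eq = code-elim (Future j 𝓖 v) (Future j ℋ w)
      (proj₂ (combine-injective (col 𝓖 v) (code (Future j 𝓖 v)) (col ℋ w) (code (Future j ℋ w)) eq))

    -- Prepending the edge makes whatever is visible from `w` visible from `v`. Hence the visible
    -- set can only shrink while the token stays in its class.
    future-mono : ∀ j 𝓖 {v w} → Edge 𝓖 v w → col 𝓖 w ≡ col 𝓖 v →
                  ∀ {x} → Future j 𝓖 w x → Future j 𝓖 v x
    future-mono j 𝓖 e eq {zero}  d            = div-cons 𝓖 (col 𝓖) e eq d
    future-mono j 𝓖 e eq {suc x} (u , cr , p) = u , cons e eq cr , p

    refine : Colouring k
    refine = record
      { N = size (suc J) ; col = colour (suc J) ; bound = bound * W + suc (size J) ; μ = μ⁺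
      ; μ≤ = λ 𝓖 v → +-mono-≤ (*-monoˡ-≤ W (μ≤ 𝓖 v)) (∣p∣≤n (S 𝓖 v))
      ; mono = mono⁺
      ; loc = λ 𝓖 ℋ eq → loc 𝓖 ℋ (colour-col (suc J) 𝓖 ℋ eq) }
      where
      -- Between untracked vertices the old colour changes at most `bound` times, so unfolding this
      -- deep covers any stretch between tracked vertices.
      J = bound
      -- `W` exceeds every cardinality of `S`, so `μ⁺` orders pairs of old measure and cardinality
      -- lexicographically.
      W = suc (suc (size J))
      S : (𝓖 : Pointed k) → V 𝓖 → Subset (suc (size J))
      S 𝓖 v = sub (Future J 𝓖 v)
      μ⁺ : (𝓖 : Pointed k) → V 𝓖 → ℕ
      μ⁺ 𝓖 v = μ 𝓖 v * W + ∣ S 𝓖 v ∣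
      mono⁺ : ∀ 𝓖 {v w} → Edge 𝓖 v w → Untracked 𝓖 v → Untracked 𝓖 w →
              (colour (suc J) 𝓖 w ≡ colour (suc J) 𝓖 v × μ⁺ 𝓖 w ≤ μ⁺ 𝓖 v) ⊎ (μ⁺ 𝓖 w < μ⁺ 𝓖 v)
      mono⁺ 𝓖 {v} {w} e unv unw with mono 𝓖 e unv unw
      ... | inj₂ lt = inj₂ (begin-strict
        μ 𝓖 w * W + ∣ S 𝓖 w ∣ <⟨ +-monoʳ-< (μ 𝓖 w * W) (s≤s (∣p∣≤n (S 𝓖 w))) ⟩
        μ 𝓖 w * W + W         ≡⟨ +-comm (μ 𝓖 w * W) W ⟩
        suc (μ 𝓖 w) * W       ≤⟨ *-monoˡ-≤ W lt ⟩
        μ 𝓖 v * W             ≤⟨ m≤m+n _ _ ⟩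
        μ 𝓖 v * W + ∣ S 𝓖 v ∣ ∎)
        where open ≤-Reasoning
      ... | inj₁ (eq , le) with sub-⊆ {P = Future J 𝓖 w} {Future J 𝓖 v} (future-mono J 𝓖 e eq)
      ...   | inj₁ S≡ = inj₁ (cong₂ combine eq (cong encode S≡) ,
                              +-mono-≤ (*-monoˡ-≤ W le) (≤-reflexive (cong ∣_∣ S≡)))
      ...   | inj₂ S< = inj₂ (+-mono-≤-< (*-monoˡ-≤ W le) S<)

  open Refine using (refine)

  level : ∀ k → ℕ → Colouring k
  level k zero    = location k
  level k (suc d) = refine (level k d)

  -- Agreement of topologies and simulation of token routes.

  -- A refined colour of a tracked vertex describes its successors only at a lower unfolding depth.
  -- Matching the out-neighbours at full colour lets the simulation restart with full fuel when the
  -- token leaves a tracked vertex.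
  record Agree {k : ℕ} (C : Colouring k) (𝓖 ℋ : Pointed k) : Set where
    open Colouring C
    field
      tracked : ∀ i → col 𝓖 (var 𝓖 i) ≡ col ℋ (var ℋ i)
      nbr     : ∀ i {v} → Edge 𝓖 (var 𝓖 i) v → Σ (V ℋ) λ w → Edge ℋ (var ℋ i) w × col 𝓖 v ≡ col ℋ w
      nbr′    : ∀ i {w} → Edge ℋ (var ℋ i) w → Σ (V 𝓖) λ v → Edge 𝓖 (var 𝓖 i) v × col ℋ w ≡ col 𝓖 v

    aliases : ∀ {i j} → var 𝓖 i ≡ var 𝓖 j → var ℋ i ≡ var ℋ j
    aliases {i} {j} = loc 𝓖 ℋ (tracked j)

  agree-sym : ∀ {k} {C : Colouring k} {𝓖 ℋ} → Agree C 𝓖 ℋ → Agree C ℋ 𝓖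
  agree-sym A = record { tracked = λ i → sym (tracked i) ; nbr = nbr′ ; nbr′ = nbr }
    where open Agree A

  module Simulation {k : ℕ} (C : Colouring k) {𝓖 ℋ : Pointed k} (A : Agree (refine C) 𝓖 ℋ) where
    open Colouring C
    open Refine C using (colour; colour-col; colour-future)
    open Agree A using (tracked; nbr; nbr′)

    agree-coarse : Agree C 𝓖 ℋ
    agree-coarse = record
      { tracked = λ i → colour-col (suc bound) 𝓖 ℋ (tracked i)
      ; nbr  = λ i e → map₂ (map₂ (colour-col (suc bound) 𝓖 ℋ)) (nbr i e)
      ; nbr′ = λ i e → map₂ (map₂ (colour-col (suc bound) ℋ 𝓖)) (nbr′ i e) }

    -- One-sided implications instead of equal refined colours, because `v` may move on quietly
    -- while `w` stays: the futures of `v` shrink and remain among those of `w`.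
    record Fuel (j : ℕ) (v : V 𝓖) (w : V ℋ) : Set where
      field
        same  : col 𝓖 v ≡ col ℋ w
        fuel  : μ 𝓖 v ≤ j
        div   : Div 𝓖 (col 𝓖) v → Div ℋ (col ℋ) w
        cross : ∀ {v′} → Crosses 𝓖 (col 𝓖) v v′ →
                Σ (V ℋ) λ w′ → Crosses ℋ (col ℋ) w w′ × colour j 𝓖 v′ ≡ colour j ℋ w′

    Sim : V 𝓖 → V ℋ → Set
    Sim v w = (∃ λ i → var 𝓖 i ≡ v × var ℋ i ≡ w) ⊎ (Untracked 𝓖 v × ∃ λ j → Fuel j v w)

    sim-enter : ∀ j {v w} → colour (suc j) 𝓖 v ≡ colour (suc j) ℋ w →
                (Untracked 𝓖 v → μ 𝓖 v ≤ j) → Sim v w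
    sim-enter j {v} {w} eq le with tracked? 𝓖 v
    ... | inj₂ (i , i↦v) = inj₁ (i , i↦v , loc 𝓖 ℋ (colour-col (suc j) 𝓖 ℋ eq) i↦v)
    ... | inj₁ un = inj₂ (un , j , record
      { same = colour-col (suc j) 𝓖 ℋ eq ; fuel = le un
      ; div = colour-future j 𝓖 ℋ eq {zero}
      ; cross = λ {v′} cr → map₂ (map₂ sym) (colour-future j 𝓖 ℋ eq {suc (colour j 𝓖 v′)} (v′ , cr , refl)) })

    sim-col : ∀ {v w} → Sim v w → col 𝓖 v ≡ col ℋ w
    sim-col (inj₁ (i , refl , refl)) = Agree.tracked agree-coarse i
    sim-col (inj₂ (_ , _ , F))       = Fuel.same F

    sim-start : ∀ {v w} → Colouring.col (refine C) 𝓖 v ≡ Colouring.col (refine C) ℋ w → Sim v w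
    sim-start eq = sim-enter bound eq λ _ → μ≤ 𝓖 _

    sim-quiet : ∀ {v v′ w} → Sim v w → Edge 𝓖 v v′ → col 𝓖 v′ ≡ col 𝓖 v → Sim v′ w
    sim-quiet {v} {v′} (inj₁ (i , i↦v , _)) e eq =
      ⊥-elim (proj₁ (same-colour-untracked 𝓖 e eq) i i↦v)
    sim-quiet {v} {v′} (inj₂ (un , j , F)) e eq = inj₂ (un′ , j , record
      { same = trans eq same ; fuel = fuel′ ; div = λ d → div (div-cons 𝓖 (col 𝓖) e eq d)
      ; cross = λ cr → cross (cons e eq cr) })
      where
      open Fuel F
      un′ = proj₂ (same-colour-untracked 𝓖 e eq)
      fuel′ : μ 𝓖 v′ ≤ j
      fuel′ with mono 𝓖 e un un′
      ... | inj₁ (_ , le) = ≤-trans le fuel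
      ... | inj₂ lt       = ≤-trans (<⇒≤ lt) fuel

    sim-cross : ∀ {v v′ w} → Sim v w → Edge 𝓖 v v′ → col 𝓖 v′ ≢ col 𝓖 v →
                Σ (V ℋ) λ w′ → Crosses ℋ (col ℋ) w w′ × Sim v′ w′
    sim-cross {v} {v′} s@(inj₁ (i , refl , refl)) e ne with w′ , e′ , eq ← nbr i e =
      w′ , last e′ (λ eq′ → ne (trans (trans (colour-col (suc bound) 𝓖 ℋ eq) eq′) (sym (sim-col s)))) ,
      sim-start eq
    sim-cross {v} {v′} (inj₂ (un , j , F)) e ne with w′ , cr , eq ← Fuel.cross F (last e ne) =
      w′ , cr , target j (Fuel.fuel F) eq
      where
      target : ∀ j {w′} → μ 𝓖 v ≤ j → colour j 𝓖 v′ ≡ colour j ℋ w′ → Sim v′ w′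
      drop : Untracked 𝓖 v′ → μ 𝓖 v′ < μ 𝓖 v
      drop un′ with mono 𝓖 e un un′
      ... | inj₁ (eq , _) = contradiction eq ne
      ... | inj₂ lt       = lt
      target (suc j) le eq = sim-enter j eq λ un′ → ≤-pred (≤-trans (drop un′) le)
      -- Without fuel `v′` must be tracked, since its measure would have to drop below 0; its colour
      -- then locates the partner.
      target zero le eq with tracked? 𝓖 v′
      ... | inj₁ un′       = contradiction (≤-trans (drop un′) le) λ ()
      ... | inj₂ (i , i↦v) = inj₁ (i , i↦v , loc 𝓖 ℋ eq i↦v)

    sim-div : ∀ {v w} → Sim v w → Div 𝓖 (col 𝓖) v → Div ℋ (col ℋ) w
    sim-div (inj₁ (i , i↦v , _)) (ρ , refl , walk) =
      ⊥-elim (proj₁ (same-colour-untracked 𝓖 (proj₁ (walk 0)) (proj₂ (walk 1))) i i↦v)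
    sim-div (inj₂ (_ , _ , F)) = Fuel.div F

-- Termination of componentwise descent.

module _ {X : Set} (_≺_ : X → X → Set) where

  Pointwise≺ : ∀ {n} → (Fin n → X) → (Fin n → X) → Set
  Pointwise≺ {n} s′ s = Σ (Fin n) λ u → s′ u ≺ s u × (∀ u′ → u′ ≢ u → s′ u′ ≡ s u′)

  -- A step lowers either the first component or the remaining vector and fixes the other, so nested
  -- induction works. For local states this says that internal moves alone cannot go on forever.
  pointwise-acc : (∀ q → Acc _≺_ q) → ∀ {n} (s : Fin n → X) → Acc Pointwise≺ s
  pointwise-acc wf {zero}  s = acc λ ()
  pointwise-acc wf {suc n} s =
    extend (wf (s zero)) (pointwise-acc wf (s ∘ suc)) s refl (λ _ → refl)
    where
    -- `s` is tied to `r` only pointwise, because a step gives pointwise equality of the untouched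
    -- components.
    extend : ∀ {q} {r : Fin n → X} → Acc _≺_ q → Acc Pointwise≺ r →
             (s : Fin (suc n) → X) → s zero ≡ q → (∀ u → s (suc u) ≡ r u) → Acc Pointwise≺ s
    extend {r = r} (acc aq) (acc ar) s refl tail = acc (below _)
      where
      below : ∀ s′ → Pointwise≺ s′ s → Acc Pointwise≺ s′
      below s′ (zero , lt , same) =
        extend (aq lt) (acc ar) s′ refl (λ u → trans (same (suc u) λ ()) (tail u))
      below s′ (suc u , lt , same) =
        extend (acc aq) (ar (u , subst (s′ (suc u) ≺_) (tail u) lt , same′))
               s′ (same zero λ ()) (λ _ → refl)
        where
        same′ : ∀ u′ → u′ ≢ u → s′ (suc u′) ≡ r u′
        same′ u′ ne = trans (same (suc u′) λ { refl → ne refl }) (tail u′)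

starPlus : ∀ {X : Set} {_∼_ : X → X → Set} {x y z} → Star _∼_ x y → TransClosure _∼_ y z →
           TransClosure _∼_ x z
starPlus ε        q = q
starPlus (e ◅ es) q = e ∷ starPlus es q

-- Local progress and the position of the token.

module Process (em : ExcludedMiddle 0ℓ) {m : ℕ} (P : Template m) where
  open Template P

  Q : Set
  Q = Fin nQ

  _≺_ : Q → Q → Set
  q′ ≺ q = ∃ λ a → δ q (int a) q′ ≡ true

  -- An infinite internal run would have no snd or rcv letter, against `paths`.
  ≺-acc : ∀ q → Acc _≺_ q
  ≺-acc q with em {Acc _≺_ q}
  ... | yes a = a
  ... | no ¬a = ⊥-elim (no-run (paths (proj₁ ∘ chain) (int ∘ letter)
                  (λ i → proj₂ (proj₁ (proj₂ (continue (chain i)))))))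
    where
    Stuck : Set
    Stuck = Σ Q λ q → ¬ Acc _≺_ q
    continue : (s : Stuck) → Σ Q λ q′ → q′ ≺ proj₁ s × ¬ Acc _≺_ q′
    continue (q , ¬a) with em {Σ Q λ q′ → q′ ≺ q × ¬ Acc _≺_ q′}
    ... | yes p = p
    ... | no ¬p = ⊥-elim (¬a (acc λ {q′} lt → back q′ lt (em {Acc _≺_ q′})))
      where
      back : ∀ q′ → q′ ≺ q → Dec (Acc _≺_ q′) → Acc _≺_ q′
      back q′ lt (yes a) = a
      back q′ lt (no ¬a) = ⊥-elim (¬p (q′ , lt , ¬a))
    chain : ℕ → Stuck
    chain zero    = q , ¬a
    chain (suc i) = proj₁ (continue (chain i)) , proj₂ (proj₂ (continue (chain i)))
    letter : ℕ → Fin (suc m)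
    letter i = proj₁ (proj₁ (proj₂ (continue (chain i))))
    no-run : ¬ (InBlocks snd rcv (int ∘ letter) ⊎ InBlocks rcv snd (int ∘ letter))
    no-run (inj₁ (_ , _ , eqs , _)) with () ← proj₁ (eqs 0)
    no-run (inj₂ (_ , _ , eqs , _)) with () ← proj₁ (eqs 0)

  -- Iterated along `≺-acc`, this brings any process of token status `b` by internal moves to a
  -- state that can perform `l`.
  Enables : Bool → PLab m → Set
  Enables b l = ∀ q → tok q ≡ b → (∃ λ q′ → q′ ≺ q) ⊎ (∃ λ q′ → δ q l q′ ≡ true)

  enables-snd : Enables true snd
  enables-snd q t with total q
  ... | int a , q′ , d = inj₁ (q′ , a , d)
  ... | snd   , q′ , d = inj₂ (q′ , d)
  ... | rcv   , q′ , d with () ← trans (sym t) (proj₁ (rcv-NT q q′ d))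

  enables-rcv : Enables false rcv
  enables-rcv q t with total q
  ... | int a , q′ , d = inj₁ (q′ , a , d)
  ... | rcv   , q′ , d = inj₂ (q′ , d)
  ... | snd   , q′ , d with () ← trans (sym t) (proj₁ (snd-TN q q′ d))

  ≺-tok : ∀ {q q′} → q′ ≺ q → tok q′ ≡ tok q
  ≺-tok (a , d) = sym (int-TT-NN _ a _ d)

  module _ (G : Topology) where
    open Topology G

    Holder : GState P G → Fin n → Set
    Holder s v = tok (s v) ≡ true × (∀ u → u ≢ v → tok (s u) ≡ false)

    holder-unique : ∀ {s v u} → Holder s v → tok (s u) ≡ true → u ≡ v
    holder-unique {s} {v} {u} (_ , off) t with u ≟ v
    ... | yes eq = eq
    ... | no ne with () ← trans (sym t) (off u ne)

    update : GState P G → Fin n → Q → GState P G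
    update s v q u with u ≟ v
    ... | yes _ = q
    ... | no  _ = s u

    update-at : ∀ s v q → update s v q v ≡ q
    update-at s v q with v ≟ v
    ... | yes _ = refl
    ... | no ne = contradiction refl ne

    update-off : ∀ s v q u → u ≢ v → update s v q u ≡ s u
    update-off s v q u ne with u ≟ v
    ... | yes eq = contradiction eq ne
    ... | no  _  = refl

    -- A global step seen from the token, for which an internal step anywhere is standing still.
    data Move (s s′ : GState P G) (v v′ : Fin n) : Set where
      local : v′ ≡ v → ∀ u → s′ u ≺ s u → (∀ u′ → u′ ≢ u → s′ u′ ≡ s u′) → Move s s′ v v′
      pass  : E v v′ ≡ true → δ (s v) snd (s′ v) ≡ true → δ (s v′) rcv (s′ v′) ≡ true →
              (∀ u → u ≢ v → u ≢ v′ → s′ u ≡ s u) → Move s s′ v v′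

    ≺-holder : ∀ {s s′ v} → (∀ u → s′ u ≡ s u ⊎ s′ u ≺ s u) → Holder s v → Holder s′ v
    ≺-holder {s} {s′} ch (on , off) =
      trans (same _) on , λ u ne → trans (same u) (off u ne)
      where
      same : ∀ u → tok (s′ u) ≡ tok (s u)
      same u = [ cong tok , ≺-tok ]′ (ch u)

    local-holder : ∀ {s s′ v} u → s′ u ≺ s u → (∀ u′ → u′ ≢ u → s′ u′ ≡ s u′) →
                   Holder s v → Holder s′ v
    local-holder {s} {s′} u lt same = ≺-holder change
      where
      change : ∀ u′ → s′ u′ ≡ s u′ ⊎ s′ u′ ≺ s u′
      change u′ with u′ ≟ u
      ... | yes refl = inj₂ lt
      ... | no ne    = inj₁ (same u′ ne)

    pass-holder : ∀ {s s′ v v′} → δ (s v) snd (s′ v) ≡ true → δ (s v′) rcv (s′ v′) ≡ true →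
                  (∀ u → u ≢ v → u ≢ v′ → s′ u ≡ s u) → Holder s v → Holder s′ v′
    pass-holder {s} {s′} {v} {v′} ds dr same (_ , off) = proj₂ (rcv-NT _ _ dr) , off′
      where
      off′ : ∀ u → u ≢ v′ → tok (s′ u) ≡ false
      off′ u ne with u ≟ v
      ... | yes refl = proj₂ (snd-TN _ _ ds)
      ... | no ne′   = trans (cong tok (same u ne′ ne)) (off u ne′)

    view : ∀ {s s′ v} → GStep P G s s′ → Holder s v → Σ (Fin n) λ v′ → Holder s′ v′ × Move s s′ v v′
    view {v = v} (internal a u d same) h =
      v , local-holder u (a , d) same h , local refl u (a , d) same
    view (token v w e ds dr same) h with refl ← holder-unique h (proj₁ (snd-TN _ _ ds)) =
      w , pass-holder ds dr same h , pass e ds dr same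

    initial-holder : Holder (s₀ P G) x
    initial-holder = on , off
      where
      on : tok (s₀ P G x) ≡ true
      on with x ≟ x
      ... | yes _ = ιt∈T
      ... | no ne = contradiction refl ne
      off : ∀ u → u ≢ x → tok (s₀ P G u) ≡ false
      off u ne with u ≟ x
      ... | yes eq = contradiction eq ne
      ... | no _   = ιn∈N

  -- Shapes of global states, and token passing under a fixed shape.

  module _ {k : ℕ} (C : Colouring k) where
    open Colouring C

    -- The observable part of a global state. It refers to no topology, so states of different
    -- systems can share it.
    Shape : Set
    Shape = Fin N × (Fin k → Q)

    record At (κ : Shape) (𝓖 : Pointed k) (s : GState P (top 𝓖)) (v : V 𝓖) : Set where
      constructor mkAt
      field
        holder : Holder (top 𝓖) s v
        colour : col 𝓖 v ≡ proj₁ κ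
        locals : ∀ i → s (var 𝓖 i) ≡ proj₂ κ i

    HasShape : Shape → (𝓖 : Pointed k) → GState P (top 𝓖) → Set
    HasShape κ 𝓖 s = Σ (V 𝓖) (At κ 𝓖 s)

    -- Only the source must have the shape: the last step of a block may change it.
    KStep : Shape → (𝓖 : Pointed k) → GState P (top 𝓖) → GState P (top 𝓖) → Set
    KStep κ 𝓖 t u = HasShape κ 𝓖 t × GStep P (top 𝓖) t u

  module Follow {k : ℕ} (C : Colouring k) (ℋ : Pointed k) where
    open Colouring C
    H = top ℋ

    -- Internal moves of an untracked process leave the shape and the holder alone, and
    -- well-foundedness makes them end where `l` is enabled.
    prepare : ∀ {b l} → Enables b l → ∀ {κ t w} → At C κ ℋ t w →
              ∀ u → Untracked ℋ u → tok (t u) ≡ b →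
              Σ (GState P H) λ t₁ → Star (KStep C κ ℋ) t t₁ × At C κ ℋ t₁ w ×
                (∀ u′ → u′ ≢ u → t₁ u′ ≡ t u′) × (∃ λ q → δ (t₁ u) l q ≡ true)
    prepare {b} {l} en {κ} {t} {w} at u un = go (≺-acc (t u)) t refl at
      where
      Prepared : GState P H → Set
      Prepared t = Σ (GState P H) λ t₁ → Star (KStep C κ ℋ) t t₁ × At C κ ℋ t₁ w ×
        (∀ u′ → u′ ≢ u → t₁ u′ ≡ t u′) × (∃ λ q → δ (t₁ u) l q ≡ true)
      go : ∀ {q} → Acc _≺_ q → ∀ t → t u ≡ q → At C κ ℋ t w → tok (t u) ≡ b → Prepared t
      go (acc rs) t refl at tk with en (t u) tk
      ... | inj₂ ready = t , ε , at , (λ _ _ → refl) , ready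
      ... | inj₁ (q′ , a , d) = after (go (rs (a , d)) t′ (update-at H t u q′) at′ (trans (≺-tok lt) tk))
        where
        t′ = update H t u q′
        lt : t′ u ≺ t u
        lt = a , trans (cong (δ (t u) (int a)) (update-at H t u q′)) d
        at′ : At C κ ℋ t′ w
        at′ = mkAt (local-holder H u lt (update-off H t u q′) (At.holder at)) (At.colour at)
                   (λ i → trans (update-off H t u q′ (var ℋ i) (un i)) (At.locals at i))
        after : Prepared t′ → Prepared t
        after (t₁ , path , at₁ , same , ready) =
          t₁ , ((w , at) , internal a u (proj₂ lt) (update-off H t u q′)) ◅ path , at₁ ,
          (λ u′ ne → trans (same u′ ne) (update-off H t u q′ u′ ne)) , ready

    -- A tracked vertex must land in the state prescribed by `f`; an untracked one can still be
    -- driven to readiness by `prepare`.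
    Ready : PLab m → GState P H → V ℋ → (Fin k → Q) → Set
    Ready l t w f = (∃ λ q → δ (t w) l q ≡ true × (∀ i → var ℋ i ≡ w → q ≡ f i)) ⊎ Untracked ℋ w

    make-ready : ∀ {b l} → Enables b l → ∀ {κ t w} → At C κ ℋ t w → ∀ u f → tok (t u) ≡ b →
                 Ready l t u f →
                 Σ (GState P H) λ t₁ → Star (KStep C κ ℋ) t t₁ × At C κ ℋ t₁ w ×
                   (∀ u′ → u′ ≢ u → t₁ u′ ≡ t u′) ×
                   (∃ λ q → δ (t₁ u) l q ≡ true × (∀ i → var ℋ i ≡ u → q ≡ f i))
    make-ready en {t = t} at u f tk (inj₁ ready) = t , ε , at , (λ _ _ → refl) , ready
    make-ready en at u f tk (inj₂ un) with t₁ , path , at₁ , same , q , d ← prepare en at u un tk =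
      t₁ , path , at₁ , same , q , d , λ i eq → contradiction eq (un i)

    -- The sender is made ready first, then the receiver. The endpoints of an edge differ, so the
    -- second preparation does not disturb the first.
    pass-token : ∀ {κ t w w′} (f : Fin k → Q) → At C κ ℋ t w → Edge ℋ w w′ →
                 Ready snd t w f → Ready rcv t w′ f →
                 (∀ i → var ℋ i ≢ w → var ℋ i ≢ w′ → t (var ℋ i) ≡ f i) →
                 Σ (GState P H) λ t′ → TransClosure (KStep C κ ℋ) t t′ × Holder H t′ w′ ×
                   (∀ i → t′ (var ℋ i) ≡ f i)
    pass-token {κ} {t} {w} {w′} f at e rs rr rest
      with t₁ , path₁ , at₁ , same₁ , q₁ , d₁ , eq₁ ←
             make-ready enables-snd at w f (proj₁ (At.holder at)) rs
      with t₂ , path₂ , at₂ , same₂ , q₂ , d₂ , eq₂ ←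
             make-ready enables-rcv at₁ w′ f (proj₂ (At.holder at₁) w′ (no-loop ℋ e ∘ sym))
               (subst (λ q → (∃ λ q′ → δ q rcv q′ ≡ true × _) ⊎ _) (sym (same₁ w′ (no-loop ℋ e ∘ sym))) rr)
      = t′ , starPlus path₁ (starPlus path₂ [ (w , at₂) , token w w′ e ds dr same ]) ,
        pass-holder H ds dr same (At.holder at₂) , locals
      where
      ne = no-loop ℋ e
      t₃ = update H t₂ w q₁
      t′ = update H t₃ w′ q₂
      t′w : t′ w ≡ q₁
      t′w = trans (update-off H t₃ w′ q₂ w ne) (update-at H t₂ w q₁)
      ds : δ (t₂ w) snd (t′ w) ≡ true
      ds = subst₂ (λ p q → δ p snd q ≡ true) (sym (same₂ w ne)) (sym t′w) d₁
      dr : δ (t₂ w′) rcv (t′ w′) ≡ true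
      dr = subst (λ q → δ (t₂ w′) rcv q ≡ true) (sym (update-at H t₃ w′ q₂)) d₂
      same : ∀ u → u ≢ w → u ≢ w′ → t′ u ≡ t₂ u
      same u n₁ n₂ = trans (update-off H t₃ w′ q₂ u n₂) (update-off H t₂ w q₁ u n₁)
      locals : ∀ i → t′ (var ℋ i) ≡ f i
      locals i = by-case (var ℋ i ≟ w) (var ℋ i ≟ w′)
        where
        by-case : Dec (var ℋ i ≡ w) → Dec (var ℋ i ≡ w′) → t′ (var ℋ i) ≡ f i
        by-case (yes eq) _        = trans (trans (cong t′ eq) t′w) (eq₁ i eq)
        by-case (no _)   (yes eq) = trans (trans (cong t′ eq) (update-at H t₃ w′ q₂)) (eq₂ i eq)
        by-case (no n₁)  (no n₂)  = trans (same _ n₁ n₂)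
          (trans (same₂ _ n₂) (trans (same₁ _ n₁) (rest i n₁ n₂)))

    pass-quietly : ∀ {κ t w w′} → At C κ ℋ t w → Edge ℋ w w′ → col ℋ w′ ≡ col ℋ w →
                   Σ (GState P H) λ t′ → TransClosure (KStep C κ ℋ) t t′ × At C κ ℋ t′ w′
    pass-quietly {κ} at e eq
      with unw , unw′ ← same-colour-untracked ℋ e eq
      with t′ , path , h , locals ← pass-token (proj₂ κ) at e (inj₂ unw) (inj₂ unw′)
                                      (λ i _ _ → At.locals at i)
      = t′ , path , mkAt h (trans eq (At.colour at)) locals

-- Mirroring a run of one system in another.

module _ (em : ExcludedMiddle 0ℓ) {m : ℕ} (P : Template m) where
  open Template P
  open Process em P
  open Refinement em
  open Refine using (refine)

  module Mirror {k : ℕ} (C : Colouring k) {𝓖 ℋ : Pointed k} (A : Agree (refine C) 𝓖 ℋ)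
    (π : ℕ → GState P (top 𝓖)) (steps : ∀ i → GStep P (top 𝓖) (π i) (π (suc i)))
    {v₀ : V 𝓖} (holder₀ : Holder (top 𝓖) (π 0) v₀) where
    open Colouring C
    open Simulation C A
    open Agree agree-coarse using (aliases)
    open Follow C ℋ

    position : ∀ i → Σ (V 𝓖) (Holder (top 𝓖) (π i))
    position zero    = v₀ , holder₀
    position (suc i) with v′ , h , _ ← view (top 𝓖) (steps i) (proj₂ (position i)) = v′ , h

    p : ℕ → V 𝓖
    p i = proj₁ (position i)

    move : ∀ i → Move (top 𝓖) (π i) (π (suc i)) (p i) (p (suc i))
    move i = proj₂ (proj₂ (view (top 𝓖) (steps i) (proj₂ (position i))))

    -- The shape cannot detect such a step, although the token may hop inside its colour class.
    record Quiet (i : ℕ) : Set where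
      constructor mkQuiet
      field
        hop    : p (suc i) ≡ p i ⊎ Edge 𝓖 (p i) (p (suc i))
        colour : col 𝓖 (p (suc i)) ≡ col 𝓖 (p i)
        locals : ∀ j → π (suc i) (var 𝓖 j) ≡ π i (var 𝓖 j)

    data Loud (i : ℕ) : Set where
      tracked-move : p (suc i) ≡ p i → ∀ j → π (suc i) (var 𝓖 j) ≺ π i (var 𝓖 j) →
                     (∀ u → u ≢ var 𝓖 j → π (suc i) u ≡ π i u) → Loud i
      crossing     : Edge 𝓖 (p i) (p (suc i)) → δ (π i (p i)) snd (π (suc i) (p i)) ≡ true →
                     δ (π i (p (suc i))) rcv (π (suc i) (p (suc i))) ≡ true →
                     (∀ u → u ≢ p i → u ≢ p (suc i) → π (suc i) u ≡ π i u) →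
                     col 𝓖 (p (suc i)) ≢ col 𝓖 (p i) → Loud i

    classify : ∀ i → Quiet i ⊎ Loud i
    classify i with move i
    ... | local stay u lt same with tracked? 𝓖 u
    ...   | inj₁ un         = inj₁ (mkQuiet (inj₁ stay) (cong (col 𝓖) stay) (λ j → same _ (un j)))
    ...   | inj₂ (j , refl) = inj₂ (tracked-move stay j lt same)
    classify i | pass e ds dr same with col 𝓖 (p (suc i)) ≟ col 𝓖 (p i)
    ...   | no ne  = inj₂ (crossing e ds dr same ne)
    ...   | yes eq with unv , unv′ ← same-colour-untracked 𝓖 e eq =
      inj₁ (mkQuiet (inj₂ e) eq λ j → same _ (unv j) (unv′ j))

    -- `≤‴` moves the lower end up, which suits recursion forward along the run.
    QuietFrom : ℕ → Set
    QuietFrom i = ∀ j → i ≤‴ j → Quiet j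

    quiet-tail : ∀ {i} → QuietFrom i → QuietFrom (suc i)
    quiet-tail q j le = q j (≤‴-step le)

    -- Internal moves descend in the well-founded pointwise order, so the token is passed after
    -- finitely many of them.
    next-hop : ∀ i → QuietFrom i →
               Σ ℕ λ j → p j ≡ p i × Edge 𝓖 (p j) (p (suc j)) × QuietFrom (suc j) ×
                 col 𝓖 (p (suc j)) ≡ col 𝓖 (p i)
    next-hop i = go i (pointwise-acc _≺_ ≺-acc (π i))
      where
      go : ∀ i → Acc (Pointwise≺ _≺_) (π i) → QuietFrom i →
           Σ ℕ λ j → p j ≡ p i × Edge 𝓖 (p j) (p (suc j)) × QuietFrom (suc j) ×
             col 𝓖 (p (suc j)) ≡ col 𝓖 (p i)
      go i (acc rs) q with move i
      ... | pass e _ _ _ = i , refl , e , quiet-tail q , Quiet.colour (q i ≤‴-refl)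
      ... | local stay u lt same with j , eq , e , q′ , c ← go (suc i) (rs (u , lt , same)) (quiet-tail q) =
        j , trans eq stay , e , q′ , trans c (cong (col 𝓖) stay)

    -- Deleting the internal moves from a quiet run leaves an infinite walk of the token.
    diverges : ∀ i → QuietFrom i → Div 𝓖 (col 𝓖) (p i)
    diverges i₀ q₀ = p ∘ index , refl , walk
      where
      Point : Set
      Point = Σ ℕ λ i → QuietFrom i × col 𝓖 (p i) ≡ col 𝓖 (p i₀)
      hop : (x : Point) → _
      hop (i , q , _) = next-hop i q
      points : ℕ → Point
      points zero    = i₀ , q₀ , refl
      points (suc n) with j , _ , _ , q , c ← hop (points n) =
        suc j , q , trans c (proj₂ (proj₂ (points n)))
      index : ℕ → ℕ
      index n = proj₁ (points n)
      walk : ∀ n → Edge 𝓖 (p (index n)) (p (index (suc n))) × col 𝓖 (p (index n)) ≡ col 𝓖 (p i₀)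
      walk n with j , eq , e , _ ← hop (points n) =
        subst (λ v → Edge 𝓖 v (p (suc j))) eq e , proj₂ (proj₂ (points n))

    -- A synchronisation point of both runs. The second alternative of `mode` is final: both tokens
    -- then stay in their colour classes forever.
    record Config : Set where
      constructor config
      field
        time  : ℕ
        {κ}   : Shape C
        state : GState P (top ℋ)
        {w}   : V ℋ
        here  : At C κ 𝓖 (π time) (p time)
        there : At C κ ℋ state w
        mode  : Sim (p time) w ⊎ (QuietFrom time × Div ℋ (col ℋ) w)

    TimePath : Shape C → ℕ → ℕ → Set
    TimePath κ = TransClosure λ i j → HasShape C κ 𝓖 (π i) × j ≡ suc i

    Block : Shape C → ℕ → GState P (top ℋ) → Set
    Block κ i t = Σ Config λ c → TimePath κ i (Config.time c) × TransClosure (KStep C κ ℋ) t (Config.state c)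

    quiet-at : ∀ {κ i} → Quiet i → At C κ 𝓖 (π i) (p i) → At C κ 𝓖 (π (suc i)) (p (suc i))
    quiet-at {i = i} q at = mkAt (proj₂ (position (suc i))) (trans (Quiet.colour q) (At.colour at))
      (λ j → trans (Quiet.locals q j) (At.locals at j))

    quiet-sim : ∀ {i w} → Quiet i → Sim (p i) w → Sim (p (suc i)) w
    quiet-sim {w = w} (mkQuiet (inj₁ stay) _ _) s = subst (λ v → Sim v w) (sym stay) s
    quiet-sim (mkQuiet (inj₂ e) c _) s = sim-quiet s e c

    module LoudStep (i : ℕ) {κ : Shape C} {t : GState P (top ℋ)} {w : V ℋ}
      (here : At C κ 𝓖 (π i) (p i)) (there : At C κ ℋ t w) (sim : Sim (p i) w) where

      goal : Fin k → Q
      goal j = π (suc i) (var 𝓖 j)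

      agree : ∀ {t w} → At C κ ℋ t w → ∀ j → t (var ℋ j) ≡ π i (var 𝓖 j)
      agree at j = trans (At.locals at j) (sym (At.locals here j))

      -- Equal colours put the same indices at `v` and `w′`, so a tracked `w′` has the local state
      -- of `v` and can copy its transition.
      mirror-ready : ∀ {l t w v w′} → At C κ ℋ t w → col 𝓖 v ≡ col ℋ w′ → δ (π i v) l (π (suc i) v) ≡ true →
                     Ready l t w′ goal
      mirror-ready {l} {t} {w} {v} {w′} at eq d with tracked? ℋ w′
      ... | inj₁ un         = inj₂ un
      ... | inj₂ (j , refl) = inj₁ (π (suc i) v ,
        subst (λ q → δ q l (π (suc i) v) ≡ true)
          (sym (trans (agree at j) (cong (π i) (back refl)))) d ,
        λ j′ eq′ → cong (π (suc i)) (sym (back eq′)))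
        where
        back : ∀ {j′} → var ℋ j′ ≡ w′ → var 𝓖 j′ ≡ v
        back = loc ℋ 𝓖 (sym eq)

      tracked-block : p (suc i) ≡ p i → ∀ j → π (suc i) (var 𝓖 j) ≺ π i (var 𝓖 j) →
                      (∀ u → u ≢ var 𝓖 j → π (suc i) u ≡ π i u) → Block κ i t
      tracked-block stay j (a , d) same =
        config (suc i) {proj₁ κ , goal} t′
          (mkAt (proj₂ (position (suc i))) (trans (cong (col 𝓖) stay) (At.colour here)) (λ _ → refl))
          (mkAt (local-holder (top ℋ) u lt off (At.holder there)) (At.colour there) locals)
          (inj₁ (subst (λ v → Sim v w) (sym stay) sim)) ,
        [ (p i , here) , refl ] , [ (w , there) , internal a u (proj₂ lt) off ]
        where
        u = var ℋ j
        t′ = update (top ℋ) t u (goal j)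
        off = update-off (top ℋ) t u (goal j)
        at-u = update-at (top ℋ) t u (goal j)
        lt : t′ u ≺ t u
        lt = a , subst₂ (λ q q′ → δ q (int a) q′ ≡ true) (sym (agree there j)) (sym at-u) d
        locals : ∀ j′ → t′ (var ℋ j′) ≡ goal j′
        locals j′ = by-case (var ℋ j′ ≟ u)
          where
          by-case : Dec (var ℋ j′ ≡ u) → t′ (var ℋ j′) ≡ goal j′
          -- Several indices may name one vertex, but they coincide in `ℋ` exactly when they do in
          -- `𝓖`.
          by-case (yes eq) = trans (trans (cong t′ eq) at-u)
            (cong (π (suc i)) (sym (Agree.aliases (agree-sym agree-coarse) eq)))
          by-case (no ne)  = trans (off _ ne) (trans (agree there j′) (sym (same _ (ne ∘ aliases))))

      -- All edges of the crossing but the last are passed quietly; the last pass reproduces the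
      -- visible effect of step `i`.
      follow : ∀ {t w w′} → Crosses ℋ (col ℋ) w w′ → At C κ ℋ t w →
               δ (π i (p i)) snd (π (suc i) (p i)) ≡ true →
               δ (π i (p (suc i))) rcv (π (suc i) (p (suc i))) ≡ true →
               (∀ u → u ≢ p i → u ≢ p (suc i) → π (suc i) u ≡ π i u) →
               col 𝓖 (p (suc i)) ≡ col ℋ w′ →
               Σ (GState P (top ℋ)) λ t′ → TransClosure (KStep C κ ℋ) t t′ × Holder (top ℋ) t′ w′ ×
                 (∀ j → t′ (var ℋ j) ≡ goal j)
      follow {t} {w} {w′} (last e _) at ds dr same eq′ =
        pass-token goal at e (mirror-ready at eq ds) (mirror-ready at eq′ dr)
          λ j ne ne′ → trans (agree at j)
            (sym (same _ (ne ∘ loc 𝓖 ℋ eq) (ne′ ∘ loc 𝓖 ℋ eq′)))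
        where
        eq : col 𝓖 (p i) ≡ col ℋ w
        eq = trans (At.colour here) (sym (At.colour at))
      follow (cons e c cr) at ds dr same eq′
        with t₁ , path₁ , at₁ ← pass-quietly at e c
        with t₂ , path₂ , rest ← follow cr at₁ ds dr same eq′
        = t₂ , path₁ ++ path₂ , rest

      loud-block : Loud i → Block κ i t
      loud-block (tracked-move stay j lt same) = tracked-block stay j lt same
      loud-block (crossing e ds dr same ne)
        with w′ , cr , sim′ ← sim-cross sim e ne
        with t′ , path , holder , locals ← follow cr there ds dr same (sim-col sim′)
        = config (suc i) {col ℋ w′ , goal} t′
            (mkAt (proj₂ (position (suc i))) (sim-col sim′) (λ _ → refl))
            (mkAt holder refl locals) (inj₁ sim′) ,
          [ (p i , here) , refl ] , path

    open LoudStep using (loud-block)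

    -- The second system waits during the quiet steps of `π` and answers the first loud one.
    -- `sim-quiet` keeps the waiting vertex a valid partner.
    block-to-loud : ∀ {i n κ t w} → i ≤‴ n → Loud n → At C κ 𝓖 (π i) (p i) → At C κ ℋ t w →
                    Sim (p i) w → Block κ i t
    block-to-loud ≤‴-refl l here there sim = loud-block _ here there sim l
    block-to-loud {i} (≤‴-step le) l here there sim with classify i
    ... | inj₂ l′ = loud-block i here there sim l′
    ... | inj₁ q with c , path , path′ ← block-to-loud le l (quiet-at q here) there (quiet-sim q sim) =
      c , ((p i , here) , refl) ∷ path , path′

    -- Each quiet step of `π` is answered by one hop of the diverging walk, so both runs continue
    -- forever in one shape.
    div-block : ∀ {i κ t w} → At C κ 𝓖 (π i) (p i) → At C κ ℋ t w → QuietFrom i →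
                Div ℋ (col ℋ) w → Block κ i t
    div-block {i} here there q (ρ , refl , walk)
      with t′ , path , there′ ← pass-quietly there (proj₁ (walk 0)) (proj₂ (walk 1))
      = config (suc i) t′ (quiet-at (q i ≤‴-refl) here) there′
          (inj₂ (quiet-tail q , ρ ∘ suc , refl ,
            λ n → proj₁ (walk (suc n)) , trans (proj₂ (walk (suc n))) (sym (proj₂ (walk 1))))) ,
        [ (p i , here) , refl ] , path

    block : (c : Config) → Block (Config.κ c) (Config.time c) (Config.state c)
    block (config i t here there (inj₂ (q , d))) = div-block here there q d
    -- Excluded middle decides whether a loud step is still to come. If none is, the token of `π`
    -- diverges and `sim-div` carries this over to `ℋ`.
    block (config i t here there (inj₁ sim)) with em {∃ λ n → i ≤‴ n × Loud n}
    ... | yes (n , le , l) = block-to-loud le l here there sim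
    ... | no ¬loud = div-block here there quiet (sim-div sim (diverges i quiet))
      where
      quiet : QuietFrom i
      quiet j le = [ id , (λ l → ⊥-elim (¬loud (j , le , l))) ]′ (classify j)

    SameShape : GState P (top 𝓖) → GState P (top ℋ) → Set
    SameShape s t = Agree C 𝓖 ℋ × Σ (Shape C) λ κ → HasShape C κ 𝓖 s × HasShape C κ ℋ t

    module _ {κ t w} (here : At C κ 𝓖 (π 0) v₀) (there : At C κ ℋ t w) (sim : Sim v₀ w) where

      configs : ℕ → Config
      configs zero    = config 0 t here there (inj₁ sim)
      configs (suc n) = proj₁ (block (configs n))

      -- Unrolling time itself yields the block numbering of the given run π.
      module T = Unroll (λ i j → j ≡ suc i) (Config.time ∘ configs)
        (λ n i → HasShape C (Config.κ (configs n)) 𝓖 (π i)) (λ n → proj₁ (proj₂ (block (configs n))))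
      module U = Unroll (GStep P (top ℋ)) (Config.state ∘ configs)
        (λ n → HasShape C (Config.κ (configs n)) ℋ) (λ n → proj₂ (proj₂ (block (configs n))))

      time≡ : ∀ i → T.run i ≡ i
      time≡ zero    = refl
      time≡ (suc i) = trans (T.run-step i) (cong suc (time≡ i))

      -- Positions in blocks of equal number belong to the same configuration and so have its shape.
      mirror : Σ (ℕ → GState P (top ℋ)) λ π′ → π′ 0 ≡ t ×
                 (∀ i → GStep P (top ℋ) (π′ i) (π′ (suc i))) × Match SameShape π π′
      mirror = U.run , refl , U.run-step , record
        { blk = T.blk ; blk′ = U.blk ; start = refl ; slow = T.blk-slow ; slow′ = U.blk-slow
        ; unb = T.blk-unb ; unb′ = U.blk-unb
        ; rel = λ i j eq → agree-coarse , Config.κ (configs (U.blk j)) ,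
            subst₂ (λ b i → HasShape C (Config.κ (configs b)) 𝓖 (π i)) eq (time≡ i) (T.run-K i) ,
            U.run-K j }

-- Bounds for prefixes and finite families.

prefix-≤ : ∀ {j k} → Prefix j k → j ≤ k
prefix-≤ done    = ≤-refl
prefix-≤ (_ ∷ p) = ≤-trans (n≤1+n _) (prefix-≤ p)

finite-bound : ∀ {N} (f : Fin N → ℕ) → Σ ℕ λ c → ∀ q → f q ≤ c
finite-bound {zero}  f = 0 , λ ()
finite-bound {suc N} f with c , le ← finite-bound (f ∘ suc) = f zero ⊔ c , λ where
  zero    → m≤m⊔n _ _
  (suc q) → ≤-trans (le q) (m≤n⊔m (f zero) c)

-- Formulas in similar pointed topologies.

module _ (em : ExcludedMiddle 0ℓ) where
  open Refinement em

  record Similar {k : ℕ} (d : ℕ) (𝓖 ℋ : Pointed k) : Set where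
    open Colouring (level k d)
    field
      agree   : Agree (level k d) 𝓖 ℋ
      initial : col 𝓖 (Topology.x (top 𝓖)) ≡ col ℋ (Topology.x (top ℋ))

  module _ {m : ℕ} (P : Template m) {k : ℕ} where
    open Template P
    open Process em P

    Related : ℕ → (𝓖 ℋ : Pointed k) → GState P (top 𝓖) → GState P (top ℋ) → Set
    Related d 𝓖 ℋ s t = Agree (level k d) 𝓖 ℋ ×
      Σ (Shape (level k d)) λ κ → HasShape (level k d) κ 𝓖 s × HasShape (level k d) κ ℋ t

    related-sym : ∀ d {𝓖 ℋ s t} → Related d 𝓖 ℋ s t → Related d ℋ 𝓖 t s
    related-sym d (A , κ , hs , ht) = agree-sym A , κ , ht , hs

    Label : (𝓖 : Pointed k) → GState P (top 𝓖) → ℕ × Fin k → Set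
    Label 𝓖 = ILab P (top 𝓖) (env 𝓖)

    related-label : ∀ d {𝓖 ℋ s t} a → Related d 𝓖 ℋ s t → Label 𝓖 s a → Label ℋ t a
    related-label d (p , j) (_ , κ , (_ , at) , (_ , at′)) =
      subst (λ q → p ∈ lab q) (trans (At.locals at j) (sym (At.locals at′ j)))

    module Sys (𝓖 : Pointed k) = Sem (GState P (top 𝓖)) (GStep P (top 𝓖)) (ℕ × Fin k) (Label 𝓖)

    related-run : ∀ d {𝓖 ℋ s t} → Related (suc d) 𝓖 ℋ s t → ∀ ρ → Sys.ValidFrom 𝓖 s ρ →
                  Σ (ℕ → GState P (top ℋ)) λ ρ′ → Sys.ValidFrom ℋ t ρ′ ×
                    Match (Related d 𝓖 ℋ) (Sys._⊙_ 𝓖 s ρ) (Sys._⊙_ ℋ t ρ′)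
    related-run d {𝓖} {ℋ} {s} {t} (A , κ , (v , at) , (w , at′)) ρ (first , rest) =
      -- `κ` carries a colour of level `suc d`; the run is matched with the coarser colour and the
      -- same local states.
      finish (mirror {Colouring.col (level k d) 𝓖 v , proj₂ κ}
        (mkAt (At.holder at) refl (At.locals at))
        (mkAt (At.holder at′) (sym (sim-col sim)) (At.locals at′)) sim)
      where
      open Simulation (level k d) A
      sim : Sim v w
      sim = sim-start (trans (At.colour at) (sym (At.colour at′)))
      steps : ∀ i → GStep P (top 𝓖) (Sys._⊙_ 𝓖 s ρ i) (Sys._⊙_ 𝓖 s ρ (suc i))
      steps zero    = first
      steps (suc i) = rest i
      open Mirror em P (level k d) A (Sys._⊙_ 𝓖 s ρ) steps (At.holder at) using (mirror)
      finish : _ → _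
      finish (π′ , refl , steps′ , M) = π′ ∘ suc , (steps′ 0 , steps′ ∘ suc) , match-resp same M
        where
        same : ∀ i → π′ i ≡ Sys._⊙_ ℋ t (π′ ∘ suc) i
        same zero    = refl
        same (suc i) = refl

    open Transfer (λ 𝓖 → GState P (top 𝓖)) (λ 𝓖 → GStep P (top 𝓖)) (ℕ × Fin k) Label Related
      related-sym related-label related-run using (transferₛ)

    similar-related : ∀ {d 𝓖 ℋ} → Similar d 𝓖 ℋ → Related d 𝓖 ℋ (s₀ P (top 𝓖)) (s₀ P (top ℋ))
    similar-related {d} {𝓖} {ℋ} S =
      agree , (col 𝓖 x𝓖 , λ i → s₀ P (top 𝓖) (var 𝓖 i)) ,
      (x𝓖 , mkAt (initial-holder (top 𝓖)) refl (λ _ → refl)) ,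
      (xℋ , mkAt (initial-holder (top ℋ)) (sym initial) same)
      where
      open Similar S
      open Colouring (level k d)
      x𝓖 = Topology.x (top 𝓖)
      xℋ = Topology.x (top ℋ)
      same : ∀ i → s₀ P (top ℋ) (var ℋ i) ≡ s₀ P (top 𝓖) (var 𝓖 i)
      same i with var 𝓖 i ≟ x𝓖 | var ℋ i ≟ xℋ
      ... | yes _  | yes _  = refl
      ... | no _   | no _   = refl
      ... | yes eq | no ne  = contradiction (loc 𝓖 ℋ initial eq) ne
      ... | no ne  | yes eq = contradiction (loc ℋ 𝓖 (sym initial) eq) ne

    similar-transfer : ∀ {d 𝓖 ℋ} φ → Similar d 𝓖 ℋ → depthS φ ≤ d →
                       Sys._⊨ₛ_ 𝓖 (s₀ P (top 𝓖)) φ → Sys._⊨ₛ_ ℋ (s₀ P (top ℋ)) φ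
    similar-transfer {d} φ S le = transferₛ d φ le (similar-related S)

  -- Finitely many types of topologies under index quantifiers.

  module Index (k d : ℕ) where
    open Colouring (level k d)

    -- The colour of each index is stored as the graph of a function, so that equal codes give equal
    -- colours index by index.
    TrackedColour NbrColour : Pointed k → Fin (k * N) → Set
    TrackedColour 𝓖 x = ∃ λ i → combine i (col 𝓖 (var 𝓖 i)) ≡ x
    NbrColour 𝓖 x = ∃ λ i → Σ (V 𝓖) λ v → Edge 𝓖 (var 𝓖 i) v × combine i (col 𝓖 v) ≡ x

    leaf : Pointed k → Fin (2 ^ (k * N) * (2 ^ (k * N) * N))
    leaf 𝓖 = combine (code (TrackedColour 𝓖)) (combine (code (NbrColour 𝓖)) (col 𝓖 (Topology.x (top 𝓖))))

    leaf-similar : ∀ 𝓖 ℋ → leaf 𝓖 ≡ leaf ℋ → Similar d 𝓖 ℋ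
    leaf-similar 𝓖 ℋ eq
      with tr , eq′ ← combine-injective (code (TrackedColour 𝓖)) _ (code (TrackedColour ℋ)) _ eq
      with nb , ini ← combine-injective (code (NbrColour 𝓖)) _ (code (NbrColour ℋ)) _ eq′
      = record { initial = ini ; agree = record
          { tracked = tracked ; nbr = nbr 𝓖 ℋ nb ; nbr′ = nbr ℋ 𝓖 (sym nb) } }
      where
      tracked : ∀ i → col 𝓖 (var 𝓖 i) ≡ col ℋ (var ℋ i)
      tracked i with i′ , e ← code-elim (TrackedColour 𝓖) (TrackedColour ℋ) tr (i , refl)
        with refl , c ← combine-injective i′ _ i _ e = sym c
      nbr : ∀ 𝓖 ℋ → code (NbrColour 𝓖) ≡ code (NbrColour ℋ) → ∀ i {v} → Edge 𝓖 (var 𝓖 i) v →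
            Σ (V ℋ) λ w → Edge ℋ (var ℋ i) w × col 𝓖 v ≡ col ℋ w
      nbr 𝓖 ℋ nb i {v} e with i′ , w , e′ , eq ← code-elim (NbrColour 𝓖) (NbrColour ℋ) nb (i , v , e , refl)
        with refl , c ← combine-injective i′ _ i _ eq = w , e′ , sym c

    _▹▹_ : ∀ {j} (𝓖 : Pointed j) → V 𝓖 → Pointed (suc j)
    𝓖 ▹▹ v = top 𝓖 ▹ (env 𝓖 ∷ʳ v)

    typeSize : ∀ {j} → j ≤‴ k → ℕ
    typeSize (≤‴-reflexive _) = 2 ^ (k * N) * (2 ^ (k * N) * N)
    typeSize {j} (≤‴-step l)  = 2 ^ (2 ^ j * (2 ^ j * typeSize l))

    mutual
      -- Types as in Ehrenfeucht-Fraïssé games: until all `k` variables are bound, a tuple is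
      -- described by the descriptions of its one-vertex extensions.
      type : ∀ {j} (l : j ≤‴ k) → Pointed j → Fin (typeSize l)
      type ≤‴-refl     𝓖 = leaf 𝓖
      type (≤‴-step l) 𝓖 = code λ x → Σ (V 𝓖) λ v → extension l 𝓖 v ≡ x

      extension : ∀ {j} (l : suc j ≤‴ k) (𝓖 : Pointed j) → V 𝓖 → Fin (2 ^ j * (2 ^ j * typeSize l))
      extension l 𝓖 v = combine (code λ i → var 𝓖 i ≡ v)
        (combine (code λ i → Edge 𝓖 (var 𝓖 i) v) (type l (𝓖 ▹▹ v)))

    extend : ∀ {j} (l : suc j ≤‴ k) 𝓖 ℋ → type (≤‴-step l) 𝓖 ≡ type (≤‴-step l) ℋ →
             ∀ v → Σ (V ℋ) λ w → extension l 𝓖 v ≡ extension l ℋ w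
    extend l 𝓖 ℋ eq v
      with w , e ← code-elim (λ x → Σ (V 𝓖) λ v → extension l 𝓖 v ≡ x)
                             (λ x → Σ (V ℋ) λ w → extension l ℋ w ≡ x) eq (v , refl)
      = w , sym e

    extension-type : ∀ {j} (l : suc j ≤‴ k) 𝓖 ℋ {v w} → extension l 𝓖 v ≡ extension l ℋ w →
                     type l (𝓖 ▹▹ v) ≡ type l (ℋ ▹▹ w)
    extension-type l 𝓖 ℋ {v} {w} eq
      with _ , eq′ ← combine-injective (code λ i → var 𝓖 i ≡ v) _ (code λ i → var ℋ i ≡ w) _ eq
      = proj₂ (combine-injective (code λ i → Edge 𝓖 (var 𝓖 i) v) _ (code λ i → Edge ℋ (var ℋ i) w) _ eq′)

    module _ {m : ℕ} (P : Template m) where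

      -- Restrictions speak only of equality with earlier vertices and of edges from them, and an
      -- extension records both.
      extension-allowed : ∀ {j} (l : suc j ≤‴ k) 𝓖 ℋ {v w} → extension l 𝓖 v ≡ extension l ℋ w →
                          ∀ r → Allowed P (top 𝓖) r (env 𝓖) v → Allowed P (top ℋ) r (env ℋ) w
      extension-allowed l 𝓖 ℋ {v} {w} eq r h
        with vs , eq′ ← combine-injective (code λ i → var 𝓖 i ≡ v) _ (code λ i → var ℋ i ≡ w) _ eq
        with es , _ ← combine-injective (code λ i → Edge 𝓖 (var 𝓖 i) v) _ (code λ i → Edge ℋ (var ℋ i) w) _ eq′
        = transfer r h
        where
        transfer : ∀ r → Allowed P (top 𝓖) r (env 𝓖) v → Allowed P (top ℋ) r (env ℋ) w
        transfer free      h = h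
        transfer (inVar Y) h = Any.map (code-elim (λ i → var 𝓖 i ≡ v) (λ i → var ℋ i ≡ w) vs) h
        transfer (inOut y) h = code-elim (λ i → Edge 𝓖 (var 𝓖 i) v) (λ i → Edge ℋ (var ℋ i) w) es h

      -- A back-and-forth argument: universal moves are answered in `𝓖`, existential ones in `ℋ`.
      quant-transfer : ∀ {j} (l : j ≤‴ k) (p : Prefix j k) (B : Pointed k → Set) →
                       (∀ 𝓖 ℋ → Similar d 𝓖 ℋ → B 𝓖 → B ℋ) →
                       ∀ 𝓖 ℋ → type l 𝓖 ≡ type l ℋ →
                       Quant P (top 𝓖) p (env 𝓖) (λ e → B (top 𝓖 ▹ e)) →
                       Quant P (top ℋ) p (env ℋ) (λ e → B (top ℋ ▹ e))
      quant-transfer ≤‴-refl done B tr 𝓖 ℋ eq h = tr 𝓖 ℋ (leaf-similar 𝓖 ℋ eq) h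
      -- The prefix ends exactly when `k` variables are bound, so this case and the next are
      -- impossible.
      quant-transfer ≤‴-refl (_ ∷ p) B tr 𝓖 ℋ eq h = contradiction (prefix-≤ p) 1+n≰n
      quant-transfer (≤‴-step l) done B tr 𝓖 ℋ eq h = contradiction (≤‴⇒≤ l) 1+n≰n
      quant-transfer (≤‴-step l) ((∀ᵢ , r) ∷ p) B tr 𝓖 ℋ eq h w allowed
        with v , e ← extend l ℋ 𝓖 (sym eq) w
        = quant-transfer l p B tr (𝓖 ▹▹ v) (ℋ ▹▹ w) (extension-type l 𝓖 ℋ (sym e))
            (h v (extension-allowed l ℋ 𝓖 e r allowed))
      quant-transfer (≤‴-step l) ((∃ᵢ , r) ∷ p) B tr 𝓖 ℋ eq (v , allowed , h)
        with w , e ← extend l 𝓖 ℋ eq v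
        = w , extension-allowed l 𝓖 ℋ e r allowed ,
          quant-transfer l p B tr (𝓖 ▹▹ v) (ℋ ▹▹ w) (extension-type l 𝓖 ℋ e) h

-- The cutoff from representatives of the types.

theorem5 : ExcludedMiddle 0ℓ →
    (m : ℕ) (𝐆 : Topology → Set) (k d : ℕ) → 1 ≤ k → 1 ≤ d →
    Σ ℕ λ c → (P : Template m) (φ : IFormula k) → IsCTLd d φ →
    ((G : Topology) → 𝐆 G → Topology.n G ≤ c → _⊨_ P G φ)
    ⇔ ((G : Topology) → 𝐆 G → _⊨_ P G φ)
theorem5 em m 𝐆 k d _ _ = proj₁ cutoff , λ P φ depth → mk⇔ (large P φ depth) (λ h G G∈ _ → h G G∈)
  where
  open Index em k d

  l : 0 ≤‴ k
  l = ≤⇒≤‴ z≤n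

  -- Types depend neither on the template nor on the formula, so the representatives, and with them
  -- the cutoff, can be fixed before both.
  Representative : Fin (typeSize l) → Set
  Representative q = Σ Topology λ G → 𝐆 G × type l (G ▹ []) ≡ q

  order : ∀ {q} → Dec (Representative q) → ℕ
  order (yes (G , _)) = Topology.n G
  -- A type that `𝐆` does not realise adds nothing to the maximum.
  order (no _)        = 0

  cutoff : Σ ℕ λ c → ∀ q → order (em {Representative q}) ≤ c
  cutoff = finite-bound λ q → order (em {Representative q})

  -- Taking the decision as an argument ensures that the representative found is the one measured by
  -- `order`.
  small : ∀ {q} (r : Dec (Representative q)) → Representative q →
          Σ (Representative q) λ (G , _) → Topology.n G ≡ order r
  small (yes r) _ = r , refl
  small (no ¬r) r = contradiction r ¬r

  large : ∀ P φ → IsCTLd d φ → ((G : Topology) → 𝐆 G → Topology.n G ≤ proj₁ cutoff → _⊨_ P G φ) →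
          (G : Topology) → 𝐆 G → _⊨_ P G φ
  large P φ depth h G G∈
    with (G′ , G′∈ , eq) , n≡ ← small (em {Representative (type l (G ▹ []))}) (G , G∈ , refl)
    = quant-transfer P l (prefix φ) (λ 𝓖 → Sys._⊨ₛ_ em P 𝓖 (s₀ P (top 𝓖)) (body φ))
        (λ 𝓖 ℋ S → similar-transfer em P (body φ) S depth) (G′ ▹ []) (G ▹ []) eq
        (h G′ G′∈ (subst (_≤ proj₁ cutoff) (sym n≡) (proj₂ cutoff _)))
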